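{- Let $B_n=\binom{2n}{n}$ for $n\ge0$ and $B_n=0$ for $n<0$, and let $D_m(B;n)=\det(B_{i+j+m})_{i,j=0}^{n-1}$. Then for every integer $m\ge1$: $D_{ -m}(B;n)=0$ for $1\le n\le m$, and for $n\ge m+1$ $$D_{ -m}(B;n)=(-1)^{\binom{m+1}{2}}\,2^{\,n-m-1}\,p_{m+1}(n-m-1).$$
   Context: For integers $m,n\ge 0$, $p_m(n)=\prod_{1\le i\le j\le m-1}\frac{2n+i+j}{i+j}$ (empty product $=1$). -}

module Defs where

open import Algebra.Bundles using (CommutativeRing)
open import Data.Fin.Base using (Fin; zero; suc; toℕ; punchIn)
open import Data.Integer.Base as ℤ using (ℤ; +_; -[1+_]; 0ℤ)
import Data.Integer.Properties as ℤ
open import Data.Nat.Base using (ℕ; zero; suc; _+_; _*_; _∸_)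
open import Data.Nat.Combinatorics using (_C_)
open import Data.Rational.Base using (ℚ; _/_)
import Data.Rational.Properties as ℚ

module Determinant {c ℓ} (R : CommutativeRing c ℓ) where
  private module R = CommutativeRing R
  open import Algebra.Properties.Semiring.Exp R.semiring using (_^_)
  open import Algebra.Properties.Semiring.Sum R.semiring using (sum)

  -- Laplace expansion along the first row; the 0 × 0 determinant is 1.
  det : ∀ {n} → (Fin n → Fin n → R.Carrier) → R.Carrier
  det {zero}  M = R.1#
  det {suc n} M = sum λ j →
    (R.- R.1#) ^ toℕ j R.* (M zero j R.* det λ r s → M (suc r) (punchIn j s))

open Determinant ℤ.+-*-commutativeRing using (det)

B : ℤ → ℤ
B (+ n)    = + ((2 * n) C n)
B -[1+ _ ] = 0ℤ

D : ℤ → (ℤ → ℤ) → ℕ → ℤ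
D m a n = det {n} λ i j → a (+ toℕ i ℤ.+ + toℕ j ℤ.+ m)

open import Algebra.Properties.CommutativeMonoid.Sum ℚ.*-1-commutativeMonoid using () renaming (sum to ∏)

-- The pairs 1 ≤ i ≤ j ≤ m - 1 are enumerated as i = 1 + u with u < m - 1
-- and j = i + v with v < m - i.
p : ℕ → ℕ → ℚ
p m n = ∏ {m ∸ 1} λ u → let i = suc (toℕ u) in
        ∏ {m ∸ i} λ v → let j = i + toℕ v in
        + (2 * n + i + j) / (i + j)

{-# OPTIONS --safe #-}
-- Let f = Σ B_n xⁿ = 1/√(1 - 4x) and g = 1/f. Multiplying the Hankel matrix of
-- xᵐ f on the right by the unitriangular Toeplitz matrix of g turns its first
-- m + 1 rows into an antidiagonal of ones, which accounts for the sign. What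
-- remains consists of the truncated convolutions
--   Σ_{k ≤ s} g_{s-k} B_{i+k} = i B_i B_s / (i + s),
-- so it is a Cauchy matrix with scaled rows and columns, and its determinant is
-- a quotient of products of factorials.
module Submission where

-- `det` is given only by expansion along the first row, whereas the argument is about column
-- operations. Expansion along an arbitrary column is therefore derived first; linearity in a column
-- and vanishing for repeated columns follow from it.
--
-- The Cauchy entries are quotients, but the determinants live in ℤ. A scaled Cauchy matrix is thus
-- described by (x + r + s) M r s = ρ r σ s, and elimination cross-multiplies: clearing the first
-- row leaves a matrix of the same kind with x + 2 for x, because (x + s)(x + r) - x (x + r + s) = r
-- s.
--
-- The formula for the truncated convolutions is proved by induction on s with i free: splitting off
-- the first term turns (i, s + 1) into (i + 1, s), which preserves the factor i + s + 1, and the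
-- recurrence (n + 1) B_(n+1) = 2 (2n + 1) B_n does the rest. At i = 0 it also yields f g = 1.
--
-- The quotient of factorials is matched with p by induction on the size N of the remaining block:
-- the numerators of p at N and at N + 1 are both contained in a triangle larger by one, which can
-- be peeled by its last column or by its first row.

open import Defs using (module Determinant)

-- Finite products of natural numbers.

module Products where
  open import Data.Nat.Base
  open import Data.Nat.Properties
  open import Data.Nat.Tactic.RingSolver using (solve-∀)
  open import Function.Base using (_∘_)
  open import Relation.Binary.PropositionalEquality

  ∏< : ℕ → (ℕ → ℕ) → ℕ
  ∏< zero    f = 1
  ∏< (suc n) f = f 0 * ∏< n (f ∘ suc)

  ∏<-cong : ∀ n {f g : ℕ → ℕ} → (∀ i → f i ≡ g i) → ∏< n f ≡ ∏< n g
  ∏<-cong zero    f≗g = refl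
  ∏<-cong (suc n) f≗g = cong₂ _*_ (f≗g 0) (∏<-cong n (f≗g ∘ suc))

  ∏<-cong-< : ∀ n {f g : ℕ → ℕ} → (∀ i → i < n → f i ≡ g i) → ∏< n f ≡ ∏< n g
  ∏<-cong-< zero    f≗g = refl
  ∏<-cong-< (suc n) f≗g = cong₂ _*_ (f≗g 0 z<s) (∏<-cong-< n λ i i<n → f≗g (suc i) (s<s i<n))

  ∏<-suc : ∀ n f → ∏< (suc n) f ≡ ∏< n f * f n
  ∏<-suc zero    f = *-comm (f 0) 1
  ∏<-suc (suc n) f = trans (cong (f 0 *_) (∏<-suc n (f ∘ suc))) (sym (*-assoc (f 0) _ _))

  ∏<-distrib-* : ∀ n f g → ∏< n (λ i → f i * g i) ≡ ∏< n f * ∏< n g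
  ∏<-distrib-* zero    f g = refl
  ∏<-distrib-* (suc n) f g = trans (cong (f 0 * g 0 *_) (∏<-distrib-* n (f ∘ suc) (g ∘ suc)))
                                   (interchange (f 0) (g 0) _ _)
    where
    interchange : ∀ a b c d → a * b * (c * d) ≡ a * c * (b * d)
    interchange = solve-∀

  ∏<-nonZero : ∀ n {f : ℕ → ℕ} → (∀ i → NonZero (f i)) → NonZero (∏< n f)
  ∏<-nonZero zero            f≢0 = _
  ∏<-nonZero (suc n) {f = f} f≢0 = m*n≢0 (f 0) (∏< n (f ∘ suc)) {{f≢0 0}} {{∏<-nonZero n (f≢0 ∘ suc)}}

-- Integer determinants: column expansion, column operations, sparse top rows.

module Determinants where
  open import Algebra.Bundles using (CommutativeRing)
  open import Data.Integer.Properties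
  open import Algebra.Properties.Semiring.Exp (CommutativeRing.semiring +-*-commutativeRing) using (_^_; ^-homo-*)
  open import Algebra.Properties.Semiring.Sum (CommutativeRing.semiring +-*-commutativeRing)
  open import Data.Fin.Base using (Fin; zero; suc; toℕ; punchIn; pinch; fromℕ<)
  open import Data.Fin.Properties using (toℕ-fromℕ<; toℕ<n)
  open import Data.Integer.Base using (ℤ; +_; 0ℤ; 1ℤ; -1ℤ; _+_; _*_; -_)
  open import Data.Integer.Tactic.RingSolver using (solve-∀)
  open import Data.Nat.Base as ℕ using (ℕ; zero; suc; _<_; _≤_; s≤s; z<s; s<s)
  import Data.Nat.Properties as ℕ
  open import Data.Nat.Combinatorics using (_C_; nC1≡n; nCk+nC[k+1]≡[n+1]C[k+1])
  open import Data.Product.Base using (∃; _,_)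
  open import Data.Vec.Functional using (Vector; insertAt; removeAt)
  open import Data.Vec.Functional.Properties using (insertAt-lookup; insertAt-punchIn; insertAt-removeAt)
  open import Function.Base using (_∘_)
  open import Relation.Binary.PropositionalEquality
  open Determinant +-*-commutativeRing using (det)
  open ≡-Reasoning
  open Products

  Matrix : ℕ → ℕ → Set
  Matrix m n = Fin m → Fin n → ℤ

  sgn : ℕ → ℤ
  sgn n = -1ℤ ^ n

  det-cong : ∀ {n} {M N : Matrix n n} → (∀ r s → M r s ≡ N r s) → det M ≡ det N
  det-cong {zero}  M≗N = refl
  det-cong {suc n} M≗N = sum-cong-≗ λ j → cong (sgn (toℕ j) *_)
    (cong₂ _*_ (M≗N zero j) (det-cong λ r s → M≗N (suc r) (punchIn j s)))

  insertColumn : ∀ {m n} → Fin (suc n) → Vector ℤ m → Matrix m n → Matrix m (suc n)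
  insertColumn p v X r = insertAt (X r) p (v r)

  removeColumn : ∀ {m n} → Fin (suc n) → Matrix m (suc n) → Matrix m n
  removeColumn p M r = removeAt (M r) p

  -- The expansion along the first column of the matrix with `v` placed in front of `X`. It does not
  -- mention a column position, so that moving a column only changes a sign.
  cofactors : ∀ {n} → Vector ℤ (suc n) → Matrix (suc n) n → ℤ
  cofactors v X = sum λ i → sgn (toℕ i) * (v i * det (removeAt X i))

  -- The inserted entry survives the deletion of any other position. `pinch j p` is its new place:
  -- one to the left if the deleted position lies before it, unchanged otherwise.
  insertAt-removed : ∀ {n} (x : Vector ℤ (suc n)) p (v : ℤ) j s →
    insertAt x p v (punchIn (punchIn p j) s) ≡ insertAt (removeAt x j) (pinch j p) v s
  insertAt-removed x zero    v j       zero    = refl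
  insertAt-removed x zero    v j       (suc s) = refl
  insertAt-removed x (suc p) v zero    s       = refl
  insertAt-removed {suc n} x (suc p) v (suc j) zero    = refl
  insertAt-removed {suc n} x (suc p) v (suc j) (suc s) = insertAt-removed (x ∘ suc) p v j s

  -- For p ≤ j the two indices are j + 1 and p, and for j < p they are j and p - 1. Either way their
  -- sum differs from p + j by one.
  sgn-punchIn-pinch : ∀ {n} (p : Fin (suc (suc n))) (j : Fin (suc n)) →
    sgn (toℕ (punchIn p j)) * sgn (toℕ (pinch j p)) ≡ - (sgn (toℕ p) * sgn (toℕ j))
  sgn-punchIn-pinch zero    j    = solve-sgn (sgn (toℕ j))
    where
    solve-sgn : ∀ a → (-1ℤ * a) * 1ℤ ≡ - (1ℤ * a)
    solve-sgn = solve-∀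
  sgn-punchIn-pinch (suc p) zero = solve-sgn (sgn (toℕ p))
    where
    solve-sgn : ∀ a → 1ℤ * a ≡ - ((-1ℤ * a) * 1ℤ)
    solve-sgn = solve-∀
  sgn-punchIn-pinch {suc n} (suc p) (suc j) = begin
    (-1ℤ * a) * (-1ℤ * b)  ≡⟨ double a b ⟩
    a * b                  ≡⟨ sgn-punchIn-pinch p j ⟩
    - (c * d)              ≡⟨ cong -_ (double c d) ⟨
    - ((-1ℤ * c) * (-1ℤ * d)) ∎
    where
    a = sgn (toℕ (punchIn p j))
    b = sgn (toℕ (pinch j p))
    c = sgn (toℕ p)
    d = sgn (toℕ j)
    double : ∀ a b → (-1ℤ * a) * (-1ℤ * b) ≡ a * b
    double = solve-∀

  -- Induction on the size. In the expansion along the first row, the term at `p` is the cofactor of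
  -- `v zero`; every other minor still contains the rest of `v` and is expanded along it by
  -- induction. Exchanging the two sums reassembles, for each lower entry of `v`, the first-row
  -- expansion of its cofactor.
  det-insertColumn : ∀ {n} p (v : Vector ℤ (suc n)) (X : Matrix (suc n) n) →
    det (insertColumn p v X) ≡ sgn (toℕ p) * cofactors v X
  det-insertColumn {zero} zero v X = solve-1 (v zero)
    where
    solve-1 : ∀ a → 1ℤ * (a * 1ℤ) + 0ℤ ≡ 1ℤ * (1ℤ * (a * 1ℤ) + 0ℤ)
    solve-1 = solve-∀
  det-insertColumn {suc n} p v X = begin
    sum term                                   ≡⟨ sum-remove {i = p} term ⟩
    term p + sum (term ∘ punchIn p)            ≡⟨ cong₂ _+_ term-p (trans (sum-cong-≗ term-j) (sym (*-distribˡ-sum (- σ) (sum ∘ double)))) ⟩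
    σ * (v zero * det (X ∘ suc)) + - σ * sum (λ j → sum (λ i → double j i))
      ≡⟨ cong (λ z → σ * (v zero * det (X ∘ suc)) + - σ * z) (∑-comm double) ⟩
    σ * (v zero * det (X ∘ suc)) + - σ * sum (λ i → sum (λ j → double j i))
      ≡⟨ cong (λ z → σ * (v zero * det (X ∘ suc)) + - σ * z) (sum-cong-≗ cof-i) ⟩
    σ * (v zero * det (X ∘ suc)) + - σ * sum (λ i → -1ℤ * rest i)
      ≡⟨ cong (λ z → σ * (v zero * det (X ∘ suc)) + - σ * z) (*-distribˡ-sum -1ℤ rest) ⟨
    σ * (v zero * det (X ∘ suc)) + - σ * (-1ℤ * sum rest) ≡⟨ regroup σ (v zero * det (X ∘ suc)) (sum rest) ⟩
    σ * (1ℤ * (v zero * det (X ∘ suc)) + sum rest) ∎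
    where
    σ = sgn (toℕ p)
    M = insertColumn p v X
    term : Fin (suc (suc n)) → ℤ
    term j = sgn (toℕ j) * (M zero j * det (λ r s → M (suc r) (punchIn j s)))
    minor : Fin (suc n) → Matrix (suc n) n
    minor j = removeColumn j (X ∘ suc)
    entry double : Fin (suc n) → Fin (suc n) → ℤ
    entry j i = sgn (toℕ i) * (v (suc i) * det (removeAt (minor j) i))
    double j i = sgn (toℕ j) * (X zero j * entry j i)
    rest : Fin (suc n) → ℤ
    rest i = sgn (toℕ (suc i)) * (v (suc i) * det (removeAt X (suc i)))

    term-p : term p ≡ σ * (v zero * det (X ∘ suc))
    term-p = cong (σ *_) (cong₂ _*_ (insertAt-lookup (X zero) p (v zero))
      (det-cong λ r s → insertAt-punchIn (X (suc r)) p (v (suc r)) s))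

    reassoc : ∀ a b x c → a * (x * (b * c)) ≡ (a * b) * (x * c)
    reassoc = solve-∀
    neg-out : ∀ a b x c → - (a * b) * (x * c) ≡ - a * (b * (x * c))
    neg-out = solve-∀

    term-j : ∀ j → term (punchIn p j) ≡ - σ * sum (double j)
    term-j j = begin
      sgn (toℕ (punchIn p j)) * (M zero (punchIn p j) * det (λ r s → M (suc r) (punchIn (punchIn p j) s)))
        ≡⟨ cong (sgn (toℕ (punchIn p j)) *_) (cong₂ _*_ (insertAt-punchIn (X zero) p (v zero) j)
             (trans (det-cong λ r s → insertAt-removed (X (suc r)) p (v (suc r)) j s)
                    (det-insertColumn (pinch j p) (v ∘ suc) (minor j)))) ⟩
      sgn (toℕ (punchIn p j)) * (X zero j * (sgn (toℕ (pinch j p)) * cofactors (v ∘ suc) (minor j)))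
        ≡⟨ reassoc (sgn (toℕ (punchIn p j))) (sgn (toℕ (pinch j p))) (X zero j) (cofactors (v ∘ suc) (minor j)) ⟩
      sgn (toℕ (punchIn p j)) * sgn (toℕ (pinch j p)) * (X zero j * cofactors (v ∘ suc) (minor j))
        ≡⟨ cong (_* (X zero j * cofactors (v ∘ suc) (minor j))) (sgn-punchIn-pinch p j) ⟩
      - (σ * sgn (toℕ j)) * (X zero j * cofactors (v ∘ suc) (minor j))
        ≡⟨ neg-out σ (sgn (toℕ j)) (X zero j) (cofactors (v ∘ suc) (minor j)) ⟩
      - σ * (sgn (toℕ j) * (X zero j * cofactors (v ∘ suc) (minor j)))
        ≡⟨ cong (λ z → - σ * (sgn (toℕ j) * z)) (*-distribˡ-sum (X zero j) (entry j)) ⟩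
      - σ * (sgn (toℕ j) * sum (λ i → X zero j * entry j i))
        ≡⟨ cong (- σ *_) (*-distribˡ-sum (sgn (toℕ j)) (λ i → X zero j * entry j i)) ⟩
      - σ * sum (double j) ∎

    swap : ∀ a x b w d → a * (x * (b * (w * d))) ≡ (b * w) * (a * (x * d))
    swap = solve-∀
    neg-in : ∀ b w d → (b * w) * d ≡ -1ℤ * ((-1ℤ * b) * (w * d))
    neg-in = solve-∀

    cof-i : ∀ i → sum (λ j → double j i) ≡ -1ℤ * rest i
    cof-i i = begin
      sum (λ j → double j i)
        ≡⟨ sum-cong-≗ (λ j → swap (sgn (toℕ j)) (X zero j) (sgn (toℕ i)) (v (suc i)) (det (removeAt (minor j) i))) ⟩
      sum (λ j → (sgn (toℕ i) * v (suc i)) * (sgn (toℕ j) * (X zero j * det (removeAt (minor j) i))))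
        ≡⟨ *-distribˡ-sum (sgn (toℕ i) * v (suc i)) (λ j → sgn (toℕ j) * (X zero j * det (removeAt (minor j) i))) ⟨
      (sgn (toℕ i) * v (suc i)) * det (removeAt X (suc i))
        ≡⟨ neg-in (sgn (toℕ i)) (v (suc i)) (det (removeAt X (suc i))) ⟩
      -1ℤ * rest i ∎

    regroup : ∀ s a b → s * a + - s * (-1ℤ * b) ≡ s * (1ℤ * a + b)
    regroup = solve-∀

  det-expand-column : ∀ {n} p (M : Matrix (suc n) (suc n)) →
    det M ≡ sgn (toℕ p) * cofactors (λ r → M r p) (removeColumn p M)
  det-expand-column p M = trans (det-cong λ r s → sym (insertAt-removeAt (M r) p s))
                                (det-insertColumn p (λ r → M r p) (removeColumn p M))

  sum-zero : ∀ {n} {f : Vector ℤ n} → (∀ i → f i ≡ 0ℤ) → sum f ≡ 0ℤ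
  sum-zero {n} f≗0 = trans (sum-cong-≗ f≗0) (sum-replicate-zero n)

  cofactors-cong : ∀ {n} {v w : Vector ℤ (suc n)} {X Y : Matrix (suc n) n} →
    (∀ r → v r ≡ w r) → (∀ r s → X r s ≡ Y r s) → cofactors v X ≡ cofactors w Y
  cofactors-cong v≗w X≗Y = sum-cong-≗ λ i → cong (sgn (toℕ i) *_)
    (cong₂ _*_ (v≗w i) (det-cong λ r s → X≗Y (punchIn i r) s))

  cofactors-linear : ∀ {n} a (v w : Vector ℤ (suc n)) X →
    cofactors (λ r → a * v r + w r) X ≡ a * cofactors v X + cofactors w X
  cofactors-linear a v w X = begin
    sum (λ i → sgn (toℕ i) * ((a * v i + w i) * δ i))
      ≡⟨ sum-cong-≗ (λ i → split (sgn (toℕ i)) a (v i) (w i) (δ i)) ⟩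
    sum (λ i → a * f i + g i)        ≡⟨ ∑-distrib-+ (λ i → a * f i) g ⟩
    sum (λ i → a * f i) + sum g      ≡⟨ cong (_+ sum g) (*-distribˡ-sum a f) ⟨
    a * sum f + sum g                ∎
    where
    δ f g : Vector ℤ _
    δ i = det (removeAt X i)
    f i = sgn (toℕ i) * (v i * δ i)
    g i = sgn (toℕ i) * (w i * δ i)
    split : ∀ s a v w d → s * ((a * v + w) * d) ≡ a * (s * (v * d)) + s * (w * d)
    split = solve-∀

  self-negative⇒0 : ∀ {i} → i ≡ - i → i ≡ 0ℤ
  self-negative⇒0 {+ zero}  _ = refl
  self-negative⇒0 {+ suc n} ()

  -- Two equal columns can be inserted in either order, which exchanges the
  -- signs +1 and -1.
  cofactors-repeated : ∀ {n} (v : Vector ℤ (suc n)) (X : Matrix (suc n) n) k →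
    (∀ r → v r ≡ X r k) → cofactors v X ≡ 0ℤ
  cofactors-repeated {suc n} v X k v≗X = begin
    cofactors v X                    ≡⟨ *-identityˡ (cofactors v X) ⟨
    sgn 0 * cofactors v X            ≡⟨ det-insertColumn zero v X ⟨
    det (insertColumn zero v X)      ≡⟨ det-cong move ⟩
    det (insertColumn (suc k) v Y)   ≡⟨ det-insertColumn (suc k) v Y ⟩
    sgn (suc (toℕ k)) * cofactors v Y ≡⟨ cong (sgn (suc (toℕ k)) *_) (self-negative⇒0 antisym) ⟩
    sgn (suc (toℕ k)) * 0ℤ           ≡⟨ *-zeroʳ (sgn (suc (toℕ k))) ⟩
    0ℤ                               ∎
    where
    Y : Matrix (suc (suc n)) (suc n)
    Y = insertColumn zero v (removeColumn k X)

    move : ∀ r s → insertColumn zero v X r s ≡ insertColumn (suc k) v Y r s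
    move r zero    = refl
    move r (suc s) = trans (sym (insertAt-removeAt (X r) k s))
      (cong (λ z → insertAt (removeAt (X r) k) k z s) (sym (v≗X r)))

    antisym : cofactors v Y ≡ - cofactors v Y
    antisym = begin
      cofactors v Y                    ≡⟨ *-identityˡ (cofactors v Y) ⟨
      sgn 0 * cofactors v Y            ≡⟨ det-insertColumn zero v Y ⟨
      det (insertColumn zero v Y)      ≡⟨ det-cong swap ⟩
      det (insertColumn (suc zero) v Y) ≡⟨ det-insertColumn (suc zero) v Y ⟩
      sgn 1 * cofactors v Y            ≡⟨ -1*i≡-i (cofactors v Y) ⟩
      - cofactors v Y                  ∎
      where
      swap : ∀ r s → insertColumn zero v Y r s ≡ insertColumn (suc zero) v Y r s
      swap r zero          = refl
      swap r (suc zero)    = refl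
      swap r (suc (suc s)) = refl

  cofactors-combination : ∀ {n m} (t : Vector ℤ m) (Y : Fin m → Vector ℤ (suc n)) X →
    (∀ k → cofactors (Y k) X ≡ 0ℤ) → cofactors (λ r → sum λ k → t k * Y k r) X ≡ 0ℤ
  cofactors-combination {n} {zero}  t Y X Y≗0 = sum-zero {suc n} λ i → *-zeroʳ (sgn (toℕ i))
  cofactors-combination {n} {suc m} t Y X Y≗0 = begin
    cofactors (λ r → t zero * Y zero r + sum (λ k → t (suc k) * Y (suc k) r)) X
      ≡⟨ cofactors-linear (t zero) (Y zero) (λ r → sum (λ k → t (suc k) * Y (suc k) r)) X ⟩
    t zero * cofactors (Y zero) X + cofactors (λ r → sum (λ k → t (suc k) * Y (suc k) r)) X
      ≡⟨ cong₂ _+_ (trans (cong (t zero *_) (Y≗0 zero)) (*-zeroʳ (t zero)))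
                   (cofactors-combination (t ∘ suc) (Y ∘ suc) X (Y≗0 ∘ suc)) ⟩
    0ℤ ∎

  -- Indices range over all of ℕ, so that a matrix can be truncated, shifted or shrunk without
  -- coercions between `Fin` types; `Δ n` takes the determinant of the leading n × n part.
  Array : Set
  Array = ℕ → ℕ → ℤ

  Δ : ℕ → Array → ℤ
  Δ n A = det {n} λ r s → A (toℕ r) (toℕ s)

  Δ-cong : ∀ n {A A′ : Array} → (∀ r s → r < n → s < n → A r s ≡ A′ r s) → Δ n A ≡ Δ n A′
  Δ-cong n A≗A′ = det-cong λ r s → A≗A′ (toℕ r) (toℕ s) (toℕ<n r) (toℕ<n s)

  splice : ∀ {a} {A : Set a} → ℕ → (ℕ → A) → (ℕ → A) → ℕ → A
  splice zero    f g s       = g s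
  splice (suc J) f g zero    = f zero
  splice (suc J) f g (suc s) = splice J (f ∘ suc) (g ∘ suc) s

  splice-< : ∀ {a} {A : Set a} {J s} (f g : ℕ → A) → s < J → splice J f g s ≡ f s
  splice-< {J = suc J} {zero}  f g _         = refl
  splice-< {J = suc J} {suc s} f g (s<s s<J) = splice-< (f ∘ suc) (g ∘ suc) s<J

  splice-at : ∀ {a} {A : Set a} J (f g : ℕ → A) → splice J f g J ≡ g J
  splice-at zero    f g = refl
  splice-at (suc J) f g = splice-at J (f ∘ suc) (g ∘ suc)

  skip : ℕ → ℕ → ℕ
  skip zero    s       = suc s
  skip (suc p) zero    = zero
  skip (suc p) (suc s) = suc (skip p s)

  toℕ-punchIn : ∀ {n} (p : Fin (suc n)) s → toℕ (punchIn p s) ≡ skip (toℕ p) (toℕ s)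
  toℕ-punchIn zero    s       = refl
  toℕ-punchIn (suc p) zero    = refl
  toℕ-punchIn (suc p) (suc s) = cong suc (toℕ-punchIn p s)

  -- The two splices differ only at position `J`, which `skip J` never attains.
  splice-skip : ∀ {a} {A : Set a} J (f g : ℕ → A) s →
    splice J f g (skip J s) ≡ splice (suc J) f g (skip J s)
  splice-skip zero    f g s       = refl
  splice-skip (suc J) f g zero    = refl
  splice-skip (suc J) f g (suc s) = splice-skip J (f ∘ suc) (g ∘ suc) s

  punchIn-below : ∀ {n} (p : Fin (suc n)) {k} → k < toℕ p → ∃ λ s → toℕ (punchIn p s) ≡ k
  punchIn-below {suc n} (suc p) {zero}  _         = zero , refl
  punchIn-below {suc n} (suc p) {suc k} (s<s k<p) with punchIn-below p k<p
  ... | s , eq = suc s , cong suc eq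

  -- Right multiplication by an upper triangular matrix with diagonal `d` and entries `t s k` above
  -- it. The columns of `A′` are exchanged for those of `A` from left to right. When column `J` is
  -- treated, all earlier ones already come from `A`, so the lower terms of the combination repeat
  -- an existing column and only the factor `d J` remains.
  Δ-triangular : ∀ n {A A′ : Array} (d : ℕ → ℕ) (t : Array) →
    (∀ r s → A′ r s ≡ + d s * A r s + sum {s} (λ k → t s (toℕ k) * A r (toℕ k))) →
    Δ n A′ ≡ + ∏< n d * Δ n A
  Δ-triangular n {A} {A′} d t A′≗ =
    trans (prefix n ℕ.≤-refl) (cong (+ ∏< n d *_) (Δ-cong n λ r s _ s<n → splice-< (A r) (A′ r) s<n))
    where
    H : ℕ → Array
    H J r = splice J (A r) (A′ r)

    column : ∀ {n} (p : Fin (suc n)) J → toℕ p ≡ J → Δ (suc n) (H J) ≡ + d J * Δ (suc n) (H (suc J))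
    column {n} p J refl = begin
      Δ (suc n) (H J)          ≡⟨ det-expand-column p (λ r s → H J (toℕ r) (toℕ s)) ⟩
      σ * cofactors (λ r → H J (toℕ r) J) (λ r s → H J (toℕ r) (toℕ (punchIn p s)))
        ≡⟨ cong (σ *_) (cofactors-cong new-column other-columns) ⟩
      σ * cofactors (λ r → + d J * u r + w r) X  ≡⟨ cong (σ *_) (cofactors-linear (+ d J) u w X) ⟩
      σ * (+ d J * cofactors u X + cofactors w X) ≡⟨ cong (λ z → σ * (+ d J * cofactors u X + z))
        (cofactors-combination (λ k → t J (toℕ k)) (λ k r → A (toℕ r) (toℕ k)) X repeated) ⟩
      σ * (+ d J * cofactors u X + 0ℤ) ≡⟨ regroup σ (+ d J) (cofactors u X) ⟩
      + d J * (σ * cofactors u X)   ≡⟨ cong (λ z → + d J * (σ * z)) (cofactors-cong {X = X} old-column λ _ _ → refl) ⟩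
      + d J * (σ * cofactors (λ r → H (suc J) (toℕ r) J) X)
        ≡⟨ cong (+ d J *_) (det-expand-column p (λ r s → H (suc J) (toℕ r) (toℕ s))) ⟨
      + d J * Δ (suc n) (H (suc J)) ∎
      where
      σ = sgn J
      u w : Vector ℤ (suc n)
      u r = A (toℕ r) J
      w r = sum {J} λ k → t J (toℕ k) * A (toℕ r) (toℕ k)
      X : Matrix (suc n) n
      X r s = H (suc J) (toℕ r) (toℕ (punchIn p s))
      new-column : ∀ r → H J (toℕ r) J ≡ + d J * u r + w r
      new-column r = trans (splice-at J (A (toℕ r)) (A′ (toℕ r))) (A′≗ (toℕ r) J)
      old-column : ∀ r → u r ≡ H (suc J) (toℕ r) J
      old-column r = sym (splice-< (A (toℕ r)) (A′ (toℕ r)) (ℕ.n<1+n J))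
      other-columns : ∀ r s → H J (toℕ r) (toℕ (punchIn p s)) ≡ X r s
      other-columns r s rewrite toℕ-punchIn p s = splice-skip J (A (toℕ r)) (A′ (toℕ r)) (toℕ s)
      repeated : ∀ k → cofactors (λ r → A (toℕ r) (toℕ k)) X ≡ 0ℤ
      repeated k with punchIn-below p (toℕ<n k)
      ... | s , eq = cofactors-repeated _ X s λ r →
        sym (trans (cong (H (suc J) (toℕ r)) eq)
                   (splice-< (A (toℕ r)) (A′ (toℕ r)) (ℕ.m<n⇒m<1+n (toℕ<n k))))
      regroup : ∀ s d c → s * (d * c + 0ℤ) ≡ d * (s * c)
      regroup = solve-∀

    step : ∀ {n} J → J < n → Δ n (H J) ≡ + d J * Δ n (H (suc J))
    step {suc n} J J<n = column (fromℕ< J<n) J (toℕ-fromℕ< J<n)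

    prefix : ∀ J → J ≤ n → Δ n A′ ≡ + ∏< J d * Δ n (H J)
    prefix zero    _   = sym (*-identityˡ (Δ n A′))
    prefix (suc J) J<n = begin
      Δ n A′                                    ≡⟨ prefix J (ℕ.<⇒≤ J<n) ⟩
      + ∏< J d * Δ n (H J)                      ≡⟨ cong (+ ∏< J d *_) (step J J<n) ⟩
      + ∏< J d * (+ d J * Δ n (H (suc J)))      ≡⟨ *-assoc (+ ∏< J d) (+ d J) (Δ n (H (suc J))) ⟨
      + ∏< J d * + d J * Δ n (H (suc J))        ≡⟨ cong (_* Δ n (H (suc J))) (pos-* (∏< J d) (d J)) ⟨
      + (∏< J d ℕ.* d J) * Δ n (H (suc J))      ≡⟨ cong (λ z → + z * Δ n (H (suc J))) (∏<-suc J d) ⟨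
      + ∏< (suc J) d * Δ n (H (suc J))          ∎

  det-scale-rows : ∀ {n} (a : ℕ → ℕ) (M : Matrix n n) →
    det (λ r s → + a (toℕ r) * M r s) ≡ + ∏< n a * det M
  det-scale-rows {zero}  a M = refl
  det-scale-rows {suc n} a M = begin
    sum (λ j → sgn (toℕ j) * (+ a 0 * M zero j * det (λ r s → + a (suc (toℕ r)) * minor j r s)))
      ≡⟨ sum-cong-≗ (λ j → cong (λ z → sgn (toℕ j) * (+ a 0 * M zero j * z)) (det-scale-rows (a ∘ suc) (minor j))) ⟩
    sum (λ j → sgn (toℕ j) * (+ a 0 * M zero j * (+ ∏< n (a ∘ suc) * det (minor j))))
      ≡⟨ sum-cong-≗ (λ j → regroup (sgn (toℕ j)) (+ a 0) (M zero j) (+ ∏< n (a ∘ suc)) (det (minor j))) ⟩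
    sum (λ j → + a 0 * + ∏< n (a ∘ suc) * (sgn (toℕ j) * (M zero j * det (minor j))))
      ≡⟨ *-distribˡ-sum (+ a 0 * + ∏< n (a ∘ suc)) (λ j → sgn (toℕ j) * (M zero j * det (minor j))) ⟨
    + a 0 * + ∏< n (a ∘ suc) * det M
      ≡⟨ cong (_* det M) (pos-* (a 0) (∏< n (a ∘ suc))) ⟨
    + ∏< (suc n) a * det M ∎
    where
    minor : Fin (suc n) → Matrix n n
    minor j r s = M (suc r) (punchIn j s)
    regroup : ∀ s a m p d → s * (a * m * (p * d)) ≡ a * p * (s * (m * d))
    regroup = solve-∀

  det-zero-row : ∀ {n} (M : Matrix (suc n) (suc n)) → (∀ j → M zero j ≡ 0ℤ) → det M ≡ 0ℤ
  det-zero-row M M₀≗0 = sum-zero λ j → trans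
    (cong (λ z → sgn (toℕ j) * (z * minor j)) (M₀≗0 j)) (vanish (sgn (toℕ j)) (minor j))
    where
    minor : Vector ℤ _
    minor j = det λ r s → M (suc r) (punchIn j s)
    vanish : ∀ s d → s * (0ℤ * d) ≡ 0ℤ
    vanish = solve-∀

  det-pivot-row : ∀ {n} p (M : Matrix (suc n) (suc n)) → (∀ j → M zero (punchIn p j) ≡ 0ℤ) →
    det M ≡ sgn (toℕ p) * (M zero p * det (λ r s → M (suc r) (punchIn p s)))
  det-pivot-row p M M₀≗0 = begin
    sum term                            ≡⟨ sum-remove {i = p} term ⟩
    term p + sum (term ∘ punchIn p)     ≡⟨ cong (λ z → term p + z) (sum-zero term≗0) ⟩
    term p + 0ℤ                         ≡⟨ +-identityʳ (term p) ⟩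
    term p                              ∎
    where
    minor term : Vector ℤ _
    minor j = det λ r s → M (suc r) (punchIn j s)
    term j = sgn (toℕ j) * (M zero j * minor j)
    vanish : ∀ s d → s * (0ℤ * d) ≡ 0ℤ
    vanish = solve-∀
    term≗0 : ∀ j → term (punchIn p j) ≡ 0ℤ
    term≗0 j = trans (cong (λ z → sgn (toℕ (punchIn p j)) * (z * minor (punchIn p j))) (M₀≗0 j))
                     (vanish (sgn (toℕ (punchIn p j))) (minor (punchIn p j)))

  -- Matrices whose top rows form an antidiagonal of ones.

  δ : Array
  δ zero    zero    = 1ℤ
  δ zero    (suc _) = 0ℤ
  δ (suc _) zero    = 0ℤ
  δ (suc m) (suc n) = δ m n

  δ-refl : ∀ n → δ n n ≡ 1ℤ
  δ-refl zero    = refl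
  δ-refl (suc n) = δ-refl n

  δ-skip : ∀ u s → δ (skip u s) u ≡ 0ℤ
  δ-skip zero    s       = refl
  δ-skip (suc u) zero    = refl
  δ-skip (suc u) (suc s) = δ-skip u s

  -- `skip u` moves `s` only when s ≥ u, and then both first arguments exceed `u`, so both sides
  -- vanish.
  δ-suc-skip : ∀ u r s → δ (suc r ℕ.+ skip u s) u ≡ δ (suc (r ℕ.+ s)) u
  δ-suc-skip zero    r s       = refl
  δ-suc-skip (suc u) r zero    = refl
  δ-suc-skip (suc u) r (suc s) rewrite ℕ.+-suc r (skip u s) | ℕ.+-suc r s = δ-suc-skip u r s

  skip-beyond : ∀ u s → skip u (u ℕ.+ s) ≡ suc (u ℕ.+ s)
  skip-beyond zero    s = refl
  skip-beyond (suc u) s = cong suc (skip-beyond u s)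

  -- The only nonzero entry of row 0 is the one in column c - 1. Deleting this row and column costs
  -- the sign (-1)^(c-1) and leaves an antidiagonal of size c - 1, so the exponents add up to 0 + 1
  -- + ... + (c - 1). The entries below the antidiagonal block are deleted with its columns.
  Δ-antidiagonal : ∀ c N (A : Array) → (∀ r s → r < c → A r s ≡ δ (suc (r ℕ.+ s)) c) →
    Δ (c ℕ.+ N) A ≡ sgn (c C 2) * Δ N (λ r s → A (c ℕ.+ r) (c ℕ.+ s))
  Δ-antidiagonal zero    N A A≗δ = sym (*-identityˡ (Δ N A))
  Δ-antidiagonal (suc u) N A A≗δ = begin
    Δ (suc (u ℕ.+ N)) A
      ≡⟨ det-pivot-row p M off-pivot ⟩
    sgn (toℕ p) * (A 0 (toℕ p) * det (λ r s → A (suc (toℕ r)) (toℕ (punchIn p s))))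
      ≡⟨ cong₂ (λ a b → sgn a * (A 0 a * b)) p≡u (det-cong λ r s → cong (A (suc (toℕ r)))
           (trans (toℕ-punchIn p s) (cong (λ z → skip z (toℕ s)) p≡u))) ⟩
    sgn u * (A 0 u * Δ (u ℕ.+ N) A′)
      ≡⟨ cong₂ (λ a b → sgn u * (a * b)) (trans (A≗δ 0 u z<s) (δ-refl u))
           (Δ-antidiagonal u N A′ A′≗δ) ⟩
    sgn u * (1ℤ * (sgn (u C 2) * Δ N (λ r s → A′ (u ℕ.+ r) (u ℕ.+ s))))
      ≡⟨ regroup (sgn u) (sgn (u C 2)) (Δ N (λ r s → A′ (u ℕ.+ r) (u ℕ.+ s))) ⟩
    sgn u * sgn (u C 2) * Δ N (λ r s → A′ (u ℕ.+ r) (u ℕ.+ s))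
      ≡⟨ cong₂ _*_ (trans (sym (^-homo-* -1ℤ u (u C 2))) (cong sgn u+uC2))
           (Δ-cong N λ r s _ _ → cong (A (suc (u ℕ.+ r))) (skip-beyond u s)) ⟩
    sgn (suc u C 2) * Δ N (λ r s → A (suc u ℕ.+ r) (suc u ℕ.+ s)) ∎
    where
    M : Matrix (suc (u ℕ.+ N)) (suc (u ℕ.+ N))
    M r s = A (toℕ r) (toℕ s)
    u<n : u < suc (u ℕ.+ N)
    u<n = s≤s (ℕ.m≤m+n u N)
    p = fromℕ< u<n
    p≡u : toℕ p ≡ u
    p≡u = toℕ-fromℕ< u<n
    off-pivot : ∀ j → M zero (punchIn p j) ≡ 0ℤ
    off-pivot j = begin
      A 0 (toℕ (punchIn p j))        ≡⟨ A≗δ 0 (toℕ (punchIn p j)) z<s ⟩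
      δ (toℕ (punchIn p j)) u        ≡⟨ cong (λ z → δ z u) (trans (toℕ-punchIn p j) (cong (λ z → skip z (toℕ j)) p≡u)) ⟩
      δ (skip u (toℕ j)) u           ≡⟨ δ-skip u (toℕ j) ⟩
      0ℤ ∎
    A′ : Array
    A′ r s = A (suc r) (skip u s)
    A′≗δ : ∀ r s → r < u → A′ r s ≡ δ (suc (r ℕ.+ s)) u
    A′≗δ r s r<u = trans (A≗δ (suc r) (skip u s) (s<s r<u)) (δ-suc-skip u r s)
    regroup : ∀ a b c → a * (1ℤ * (b * c)) ≡ a * b * c
    regroup = solve-∀
    u+uC2 : u ℕ.+ u C 2 ≡ suc u C 2
    u+uC2 = trans (cong (ℕ._+ u C 2) (sym (nC1≡n u))) (nCk+nC[k+1]≡[n+1]C[k+1] u 1)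

-- Division-free evaluation of scaled Cauchy determinants.

module Cauchy where
  open import Data.Integer.Base using (+_; 0ℤ; 1ℤ; _+_; _*_; _-_; -_)
  open import Data.Integer.Properties
  open import Data.Integer.Tactic.RingSolver using (solve-∀)
  open import Data.Nat.Base as ℕ using (ℕ; zero; suc; _!)
  import Data.Nat.Properties as ℕ
  import Data.Nat.Tactic.RingSolver as ℕ
  open import Data.Fin.Base using (zero; suc; toℕ)
  open import Function.Base using (_∘_)
  open import Relation.Binary.PropositionalEquality
  open import Algebra.Bundles using (CommutativeRing)
  open import Algebra.Properties.Semiring.Sum (CommutativeRing.semiring +-*-commutativeRing)
  open ≡-Reasoning
  open Products
  open Determinants

  cauchyProduct : ℕ → ℕ → ℕ
  cauchyProduct x n = ∏< n λ r → ∏< n λ s → x ℕ.+ (r ℕ.+ s)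

  -- The square of the Vandermonde product of 0, 1, ..., n - 1. In Cauchy's formula it arises once
  -- from the row nodes x + r and once from the column nodes s.
  factorialSquares : ℕ → ℕ
  factorialSquares n = ∏< n λ k → k ! ℕ.* k !

  ∏<-suc≡! : ∀ n → ∏< n suc ≡ n !
  ∏<-suc≡! zero    = refl
  ∏<-suc≡! (suc n) = begin
    ∏< (suc n) suc       ≡⟨ ∏<-suc n suc ⟩
    ∏< n suc ℕ.* suc n   ≡⟨ cong (ℕ._* suc n) (∏<-suc≡! n) ⟩
    n ! ℕ.* suc n        ≡⟨ ℕ.*-comm (n !) (suc n) ⟩
    suc n !              ∎

  -- Removing the first row and column shifts both r and s, hence the parameter by 2, just as one
  -- elimination step does for the matrix.
  cauchyProduct-head : ∀ x n → cauchyProduct x (suc n) ≡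
    x ℕ.* (∏< n (λ i → x ℕ.+ suc i) ℕ.* ∏< n (λ i → x ℕ.+ suc i)) ℕ.* cauchyProduct (2 ℕ.+ x) n
  cauchyProduct-head x n = begin
    (x ℕ.+ 0) ℕ.* q ℕ.* ∏< n (λ r → (x ℕ.+ (suc r ℕ.+ 0)) ℕ.* ∏< n (λ s → x ℕ.+ (suc r ℕ.+ suc s)))
      ≡⟨ cong₂ (λ a b → a ℕ.* q ℕ.* b) (ℕ.+-identityʳ x)
           (∏<-distrib-* n (λ r → x ℕ.+ (suc r ℕ.+ 0)) (λ r → ∏< n (λ s → x ℕ.+ (suc r ℕ.+ suc s)))) ⟩
    x ℕ.* q ℕ.* (∏< n (λ r → x ℕ.+ (suc r ℕ.+ 0)) ℕ.* ∏< n (λ r → ∏< n (λ s → x ℕ.+ (suc r ℕ.+ suc s))))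
      ≡⟨ cong₂ (λ a b → x ℕ.* q ℕ.* (a ℕ.* b)) (∏<-cong n λ r → cong (λ z → x ℕ.+ suc z) (ℕ.+-identityʳ r))
           (∏<-cong n λ r → ∏<-cong n λ s → shift x r s) ⟩
    x ℕ.* q ℕ.* (q ℕ.* cauchyProduct (2 ℕ.+ x) n) ≡⟨ regroup x q (cauchyProduct (2 ℕ.+ x) n) ⟩
    x ℕ.* (q ℕ.* q) ℕ.* cauchyProduct (2 ℕ.+ x) n ∎
    where
    q = ∏< n λ i → x ℕ.+ suc i
    shift : ∀ x r s → x ℕ.+ (suc r ℕ.+ suc s) ≡ 2 ℕ.+ x ℕ.+ (r ℕ.+ s)
    shift = ℕ.solve-∀
    regroup : ∀ x q v → x ℕ.* q ℕ.* (q ℕ.* v) ≡ x ℕ.* (q ℕ.* q) ℕ.* v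
    regroup = ℕ.solve-∀

  -- One step of Gaussian elimination on M r s = ρ r σ s / (x + r + s). Writing x as a successor
  -- keeps all denominators positive, so they can be cancelled in ℤ.
  module Elimination (x₀ : ℕ) (M : Array) (ρ σ : ℕ → ℕ)
    (M-cauchy : ∀ r s → + (suc x₀ ℕ.+ (r ℕ.+ s)) * M r s ≡ + (ρ r ℕ.* σ s)) where

    x : ℕ
    x = suc x₀

    -- The multipliers are read off row 0, where M 0 (s+1) = ρ 0 σ (s+1) / (x + s + 1) and M 0 0 = ρ
    -- 0 σ 0 / x: cross-multiplying makes the two contributions cancel there.
    cleared : Array
    cleared r zero    = M r 0
    cleared r (suc s) = + (σ 0 ℕ.* (x ℕ.+ suc s)) * M r (suc s) - + (σ (suc s) ℕ.* x) * M r 0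

    scale : ℕ → ℕ
    scale zero    = 1
    scale (suc s) = σ 0 ℕ.* (x ℕ.+ suc s)

    combination : Array
    combination (suc s) zero = - + (σ (suc s) ℕ.* x)
    combination _       _    = 0ℤ

    cleared-triangular : ∀ r s → cleared r s ≡
      + scale s * M r s + sum {s} (λ k → combination s (toℕ k) * M r (toℕ k))
    cleared-triangular r zero    = solve-1 (M r 0)
      where
      solve-1 : ∀ a → a ≡ 1ℤ * a + 0ℤ
      solve-1 = solve-∀
    cleared-triangular r (suc s) = begin
      a - + (σ (suc s) ℕ.* x) * M r 0                      ≡⟨ cong (λ z → a + z) (neg-distribˡ-* (+ (σ (suc s) ℕ.* x)) (M r 0)) ⟩
      a + - + (σ (suc s) ℕ.* x) * M r 0                    ≡⟨ cong (λ z → a + z) (+-identityʳ (- + (σ (suc s) ℕ.* x) * M r 0)) ⟨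
      a + (- + (σ (suc s) ℕ.* x) * M r 0 + 0ℤ)             ≡⟨ cong (λ z → a + (- + (σ (suc s) ℕ.* x) * M r 0 + z))
                                                               (sum-zero {s} λ k → refl) ⟨
      a + (- + (σ (suc s) ℕ.* x) * M r 0 + sum {s} (λ k → 0ℤ * M r (suc (toℕ k)))) ∎
      where a = + (σ 0 ℕ.* (x ℕ.+ suc s)) * M r (suc s)

    M-column-0 : ∀ r → (+ x + + r) * M r 0 ≡ + ρ r * + σ 0
    M-column-0 r = begin
      (+ x + + r) * M r 0               ≡⟨ cong (λ z → + (x ℕ.+ z) * M r 0) (ℕ.+-identityʳ r) ⟨
      + (x ℕ.+ (r ℕ.+ 0)) * M r 0       ≡⟨ M-cauchy r 0 ⟩
      + (ρ r ℕ.* σ 0)                   ≡⟨ pos-* (ρ r) (σ 0) ⟩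
      + ρ r * + σ 0                     ∎

    -- With S = s + 1, the numerators combine by (x + S)(x + r) - x (x + r + S) = r S. After scaling
    -- row r by x + r the cleared matrix is thus again of Cauchy type, and the factor r makes row 0
    -- vanish.
    cleared-cauchy : ∀ r s → + (x ℕ.+ (r ℕ.+ suc s)) * (+ (x ℕ.+ r) * cleared r (suc s)) ≡
      + (ρ r ℕ.* r ℕ.* (σ 0 ℕ.* (σ (suc s) ℕ.* suc s)))
    cleared-cauchy r s = begin
      + (x ℕ.+ (r ℕ.+ suc s)) * (+ (x ℕ.+ r) * cleared r (suc s))
        ≡⟨ cong (λ z → + (x ℕ.+ (r ℕ.+ suc s)) * (+ (x ℕ.+ r) * z))
             (cong₂ (λ a b → a * M r (suc s) - b * M r 0) (pos-* (σ 0) (x ℕ.+ suc s)) (pos-* (σ (suc s)) x)) ⟩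
      (X + (R + S)) * ((X + R) * (c * (X + S) * M r (suc s) - d * X * M r 0))
        ≡⟨ collect X R S c d (M r (suc s)) (M r 0) ⟩
      c * (X + S) * (X + R) * ((X + (R + S)) * M r (suc s)) - d * X * (X + (R + S)) * ((X + R) * M r 0)
        ≡⟨ cong₂ (λ a b → c * (X + S) * (X + R) * a - d * X * (X + (R + S)) * b)
             (trans (M-cauchy r (suc s)) (pos-* (ρ r) (σ (suc s)))) (M-column-0 r) ⟩
      c * (X + S) * (X + R) * (+ ρ r * d) - d * X * (X + (R + S)) * (+ ρ r * c)
        ≡⟨ cancel X R S c d (+ ρ r) ⟩
      + ρ r * R * (c * (d * S))
        ≡⟨ cong₂ _*_ (pos-* (ρ r) r) (trans (pos-* (σ 0) (σ (suc s) ℕ.* suc s)) (cong (c *_) (pos-* (σ (suc s)) (suc s)))) ⟨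
      + (ρ r ℕ.* r) * + (σ 0 ℕ.* (σ (suc s) ℕ.* suc s))
        ≡⟨ pos-* (ρ r ℕ.* r) (σ 0 ℕ.* (σ (suc s) ℕ.* suc s)) ⟨
      + (ρ r ℕ.* r ℕ.* (σ 0 ℕ.* (σ (suc s) ℕ.* suc s))) ∎
      where
      X = + x
      R = + r
      S = + suc s
      c = + σ 0
      d = + σ (suc s)
      collect : ∀ X R S c d m n → (X + (R + S)) * ((X + R) * (c * (X + S) * m - d * X * n)) ≡
        c * (X + S) * (X + R) * ((X + (R + S)) * m) - d * X * (X + (R + S)) * ((X + R) * n)
      collect = solve-∀
      cancel : ∀ X R S c d p → c * (X + S) * (X + R) * (p * d) - d * X * (X + (R + S)) * (p * c) ≡
        p * R * (c * (d * S))
      cancel = solve-∀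

    cleared-row-0 : ∀ s → cleared 0 (suc s) ≡ 0ℤ
    cleared-row-0 s = *-cancelˡ-≡ (+ x) (cleared 0 (suc s)) 0ℤ
      (*-cancelˡ-≡ (+ (x ℕ.+ suc s)) (+ x * cleared 0 (suc s)) (+ x * 0ℤ) (begin
        + (x ℕ.+ suc s) * (+ x * cleared 0 (suc s))
          ≡⟨ cong (λ z → + (x ℕ.+ suc s) * (+ z * cleared 0 (suc s))) (ℕ.+-identityʳ x) ⟨
        + (x ℕ.+ suc s) * (+ (x ℕ.+ 0) * cleared 0 (suc s))
          ≡⟨ cleared-cauchy 0 s ⟩
        + (ρ 0 ℕ.* 0 ℕ.* (σ 0 ℕ.* (σ (suc s) ℕ.* suc s)))
          ≡⟨ cong (λ z → + (z ℕ.* (σ 0 ℕ.* (σ (suc s) ℕ.* suc s)))) (ℕ.*-zeroʳ (ρ 0)) ⟩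
        0ℤ
          ≡⟨ trans (cong (+ (x ℕ.+ suc s) *_) (*-zeroʳ (+ x))) (*-zeroʳ (+ (x ℕ.+ suc s))) ⟨
        + (x ℕ.+ suc s) * (+ x * 0ℤ) ∎))

    reduced : Array
    reduced r s = + (x ℕ.+ suc r) * cleared (suc r) (suc s)

    reduced-cauchy : ∀ r s → + (2 ℕ.+ x ℕ.+ (r ℕ.+ s)) * reduced r s ≡
      + (ρ (suc r) ℕ.* suc r ℕ.* (σ 0 ℕ.* (σ (suc s) ℕ.* suc s)))
    reduced-cauchy r s = trans (cong (λ z → + z * reduced r s) (shift x r s)) (cleared-cauchy (suc r) s)
      where
      shift : ∀ x r s → 2 ℕ.+ x ℕ.+ (r ℕ.+ s) ≡ x ℕ.+ (suc r ℕ.+ suc s)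
      shift = ℕ.solve-∀

    q : ℕ → ℕ
    q n = ∏< n λ i → x ℕ.+ suc i

    σ₀ : ℕ → ℕ
    σ₀ n = ∏< n λ _ → σ 0

    -- The accumulated cost of one step: `σ₀ n` and one `q n` come from scaling the columns, the
    -- other `q n` from scaling the rows, and x turns the pivot `M 0 0` into ρ 0 σ 0.
    Δ-reduced : ∀ n → + x * (+ q n * (+ σ₀ n * + q n * Δ (suc n) M)) ≡ + ρ 0 * + σ 0 * Δ n reduced
    Δ-reduced n = begin
      + x * (+ q n * (+ σ₀ n * + q n * Δ (suc n) M))
        ≡⟨ cong (λ z → + x * (+ q n * (z * Δ (suc n) M)))
             (trans (cong +_ (trans (ℕ.*-identityˡ _) (∏<-distrib-* n (λ _ → σ 0) (λ i → x ℕ.+ suc i)))) (pos-* (σ₀ n) (q n))) ⟨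
      + x * (+ q n * (+ ∏< (suc n) scale * Δ (suc n) M))
        ≡⟨ cong (λ z → + x * (+ q n * z)) (Δ-triangular (suc n) scale combination cleared-triangular) ⟨
      + x * (+ q n * Δ (suc n) cleared)
        ≡⟨ cong (λ z → + x * (+ q n * z)) (det-pivot-row {n} zero (λ r s → cleared (toℕ r) (toℕ s)) (cleared-row-0 ∘ toℕ)) ⟩
      + x * (+ q n * (1ℤ * (M 0 0 * minor)))
        ≡⟨ regroup (+ x) (+ q n) (M 0 0) minor ⟩
      (+ x + 0ℤ) * M 0 0 * (+ q n * minor)
        ≡⟨ cong₂ _*_ (M-column-0 0) (sym (det-scale-rows {n} (λ r → x ℕ.+ suc r) (λ r s → cleared (suc (toℕ r)) (suc (toℕ s))))) ⟩
      + ρ 0 * + σ 0 * Δ n reduced ∎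
      where
      minor = Δ n λ r s → cleared (suc r) (suc s)
      regroup : ∀ x q m d → x * (q * (1ℤ * (m * d))) ≡ (x + 0ℤ) * m * (q * d)
      regroup = solve-∀

  -- Induction on n through the reduced matrix. Its row and column scalings acquire factors r + 1
  -- and s + 1, whose products supply the n! squared that completes `factorialSquares (suc n)`.
  -- Since σ 0 is nonzero, the power `σ₀ n` introduced by the column scaling can be cancelled.
  Δ-cauchy : ∀ n x (M : Array) (ρ σ : ℕ → ℕ) → (∀ s → ℕ.NonZero (σ s)) →
    (∀ r s → + (suc x ℕ.+ (r ℕ.+ s)) * M r s ≡ + (ρ r ℕ.* σ s)) →
    + cauchyProduct (suc x) n * Δ n M ≡ + (∏< n ρ ℕ.* ∏< n σ ℕ.* factorialSquares n)
  Δ-cauchy zero    x M ρ σ σ≢0 M-cauchy = refl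
  Δ-cauchy (suc n) x M ρ σ σ≢0 M-cauchy =
    *-cancelˡ-≡ (+ σ₀ n) _ _ {{∏<-nonZero n λ _ → σ≢0 0}} (begin
      + σ₀ n * (+ cauchyProduct (suc x) (suc n) * Δ (suc n) M)
        ≡⟨ cong (λ z → + σ₀ n * (z * Δ (suc n) M)) (trans (cong +_ (cauchyProduct-head (suc x) n)) split-product) ⟩
      + σ₀ n * (+ suc x * (+ q n * + q n) * V * Δ (suc n) M)
        ≡⟨ regroup₁ (+ σ₀ n) (+ suc x) (+ q n) V (Δ (suc n) M) ⟩
      V * (+ suc x * (+ q n * (+ σ₀ n * + q n * Δ (suc n) M)))
        ≡⟨ cong (V *_) (Δ-reduced n) ⟩
      V * (+ ρ 0 * + σ 0 * Δ n reduced)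
        ≡⟨ regroup₂ V (+ ρ 0) (+ σ 0) (Δ n reduced) ⟩
      + ρ 0 * + σ 0 * (V * Δ n reduced)
        ≡⟨ cong (+ ρ 0 * + σ 0 *_) (Δ-cauchy n (2 ℕ.+ x) reduced ρ′ σ′
             (λ s → ℕ.m*n≢0 (σ 0) _ {{σ≢0 0}} {{ℕ.m*n≢0 (σ (suc s)) (suc s) {{σ≢0 (suc s)}}}}) reduced-cauchy) ⟩
      + ρ 0 * + σ 0 * + (∏< n ρ′ ℕ.* ∏< n σ′ ℕ.* factorialSquares n)
        ≡⟨ cong (_* + (∏< n ρ′ ℕ.* ∏< n σ′ ℕ.* factorialSquares n)) (pos-* (ρ 0) (σ 0)) ⟨
      + (ρ 0 ℕ.* σ 0) * + (∏< n ρ′ ℕ.* ∏< n σ′ ℕ.* factorialSquares n)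
        ≡⟨ pos-* (ρ 0 ℕ.* σ 0) _ ⟨
      + (ρ 0 ℕ.* σ 0 ℕ.* (∏< n ρ′ ℕ.* ∏< n σ′ ℕ.* factorialSquares n))
        ≡⟨ cong +_ products ⟩
      + (σ₀ n ℕ.* (∏< (suc n) ρ ℕ.* ∏< (suc n) σ ℕ.* factorialSquares (suc n)))
        ≡⟨ pos-* (σ₀ n) _ ⟩
      + σ₀ n * + (∏< (suc n) ρ ℕ.* ∏< (suc n) σ ℕ.* factorialSquares (suc n)) ∎)
    where
    open Elimination x M ρ σ M-cauchy hiding (x)
    V = + cauchyProduct (3 ℕ.+ x) n
    ρ′ σ′ : ℕ → ℕ
    ρ′ r = ρ (suc r) ℕ.* suc r
    σ′ s = σ 0 ℕ.* (σ (suc s) ℕ.* suc s)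

    split-product : + (suc x ℕ.* (q n ℕ.* q n) ℕ.* cauchyProduct (3 ℕ.+ x) n) ≡ + suc x * (+ q n * + q n) * V
    split-product = trans (pos-* (suc x ℕ.* (q n ℕ.* q n)) (cauchyProduct (3 ℕ.+ x) n))
      (cong (_* V) (trans (pos-* (suc x) (q n ℕ.* q n)) (cong (+ suc x *_) (pos-* (q n) (q n)))))

    regroup₁ : ∀ c x q v d → c * (x * (q * q) * v * d) ≡ v * (x * (q * (c * q * d)))
    regroup₁ = solve-∀
    regroup₂ : ∀ v r s d → v * (r * s * d) ≡ r * s * (v * d)
    regroup₂ = solve-∀

    products : ρ 0 ℕ.* σ 0 ℕ.* (∏< n ρ′ ℕ.* ∏< n σ′ ℕ.* factorialSquares n) ≡
      σ₀ n ℕ.* (∏< (suc n) ρ ℕ.* ∏< (suc n) σ ℕ.* factorialSquares (suc n))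
    products = begin
      ρ 0 ℕ.* σ 0 ℕ.* (∏< n ρ′ ℕ.* ∏< n σ′ ℕ.* factorialSquares n)
        ≡⟨ cong₂ (λ a b → ρ 0 ℕ.* σ 0 ℕ.* (a ℕ.* b ℕ.* factorialSquares n)) ∏ρ′ ∏σ′ ⟩
      ρ 0 ℕ.* σ 0 ℕ.* ((a ℕ.* n !) ℕ.* (σ₀ n ℕ.* (b ℕ.* n !)) ℕ.* factorialSquares n)
        ≡⟨ regroup (ρ 0) (σ 0) a (n !) (σ₀ n) b (factorialSquares n) ⟩
      σ₀ n ℕ.* (ρ 0 ℕ.* a ℕ.* (σ 0 ℕ.* b) ℕ.* (factorialSquares n ℕ.* (n ! ℕ.* n !)))
        ≡⟨ cong (λ z → σ₀ n ℕ.* (ρ 0 ℕ.* a ℕ.* (σ 0 ℕ.* b) ℕ.* z)) (∏<-suc n (λ k → k ! ℕ.* k !)) ⟨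
      σ₀ n ℕ.* (∏< (suc n) ρ ℕ.* ∏< (suc n) σ ℕ.* factorialSquares (suc n)) ∎
      where
      a = ∏< n (ρ ∘ suc)
      b = ∏< n (σ ∘ suc)
      ∏ρ′ : ∏< n ρ′ ≡ a ℕ.* n !
      ∏ρ′ = trans (∏<-distrib-* n (ρ ∘ suc) suc) (cong (a ℕ.*_) (∏<-suc≡! n))
      ∏σ′ : ∏< n σ′ ≡ σ₀ n ℕ.* (b ℕ.* n !)
      ∏σ′ = trans (∏<-distrib-* n (λ _ → σ 0) (λ s → σ (suc s) ℕ.* suc s))
        (cong (σ₀ n ℕ.*_) (trans (∏<-distrib-* n (σ ∘ suc) suc) (cong (b ℕ.*_) (∏<-suc≡! n))))
      regroup : ∀ r s a f c b u → r ℕ.* s ℕ.* ((a ℕ.* f) ℕ.* (c ℕ.* (b ℕ.* f)) ℕ.* u) ≡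
        c ℕ.* (r ℕ.* a ℕ.* (s ℕ.* b) ℕ.* (u ℕ.* (f ℕ.* f)))
      regroup = ℕ.solve-∀

-- Factorial form and recurrence of the central binomial coefficients.

module CentralBinomials where
  open import Data.Nat.Base
  open import Data.Nat.Properties
  open import Data.Nat.Combinatorics using (_C_; nCk≡n!/k![n-k]!; k![n∸k]!∣n!)
  open import Data.Nat.DivMod using (m/n*n≡m)
  open import Data.Nat.Tactic.RingSolver using (solve-∀)
  open import Relation.Binary.PropositionalEquality
  open ≡-Reasoning

  b : ℕ → ℕ
  b n = (2 * n) C n

  b-factorial : ∀ n → b n * (n ! * n !) ≡ (2 * n) !
  b-factorial n = begin
    b n * (n ! * n !)
      ≡⟨ cong (λ z → b n * (n ! * z !)) (trans (m+n∸m≡n n (n + 0)) (+-identityʳ n)) ⟨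
    b n * (n ! * (2 * n ∸ n) !)
      ≡⟨ cong (_* (n ! * (2 * n ∸ n) !)) (nCk≡n!/k![n-k]! n≤2n) ⟩
    ((2 * n) ! / (n ! * (2 * n ∸ n) !)) * (n ! * (2 * n ∸ n) !)
      ≡⟨ m/n*n≡m (k![n∸k]!∣n! n≤2n) ⟩
    (2 * n) ! ∎
    where
    n≤2n : n ≤ 2 * n
    n≤2n = m≤m+n n (n + 0)
    instance _ = n !* (2 * n ∸ n) !≢0

  b≢0 : ∀ n → NonZero (b n)
  b≢0 n = m*n≢0⇒m≢0 (b n) {{subst NonZero (sym (b-factorial n)) ((2 * n) !≢0)}}

  b-suc : ∀ n → suc n * b (suc n) ≡ 2 * suc (2 * n) * b n
  b-suc n = *-cancelʳ-≡ _ _ (suc n * (n ! * n !)) (begin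
    suc n * b (suc n) * (suc n * (n ! * n !))   ≡⟨ regroup₁ n (b (suc n)) (n !) ⟩
    b (suc n) * (suc n ! * suc n !)             ≡⟨ b-factorial (suc n) ⟩
    (2 * suc n) !                               ≡⟨ cong _! (double-suc n) ⟩
    suc (suc (2 * n)) * (suc (2 * n) * (2 * n) !) ≡⟨ cong (λ z → suc (suc (2 * n)) * (suc (2 * n) * z)) (b-factorial n) ⟨
    suc (suc (2 * n)) * (suc (2 * n) * (b n * (n ! * n !))) ≡⟨ regroup₂ n (b n) (n ! * n !) ⟩
    2 * suc (2 * n) * b n * (suc n * (n ! * n !)) ∎)
    where
    instance
      _ = m*n≢0 (suc n) (n ! * n !) {{_}} {{n !* n !≢0}}
    double-suc : ∀ n → 2 * suc n ≡ suc (suc (2 * n))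
    double-suc = solve-∀
    regroup₁ : ∀ n b f → suc n * b * (suc n * (f * f)) ≡ b * (suc n * f * (suc n * f))
    regroup₁ = solve-∀
    regroup₂ : ∀ n b f → suc (suc (2 * n)) * (suc (2 * n) * (b * f)) ≡ 2 * suc (2 * n) * b * (suc n * f)
    regroup₂ = solve-∀

-- Truncated convolutions with the inverse power series.

module Convolution where
  open import Data.Fin.Base using (toℕ)
  open import Data.Integer.Base using (ℤ; +_; 0ℤ; 1ℤ; _+_; _*_; _-_)
  open import Data.Integer.Properties
  open import Data.Integer.Tactic.RingSolver using (solve-∀)
  open import Data.Nat.Base as ℕ using (ℕ; zero; suc; _∸_; s≤s)
  import Data.Nat.Properties as ℕ
  import Data.Nat.Tactic.RingSolver as ℕ
  open import Relation.Binary.PropositionalEquality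
  open import Algebra.Bundles using (CommutativeRing)
  open import Algebra.Properties.Semiring.Sum (CommutativeRing.semiring +-*-commutativeRing)
  open ≡-Reasoning
  open Determinants
  open CentralBinomials

  -- The coefficients of √(1 - 4x) = (1 - 4x) / √(1 - 4x), the power series
  -- inverse to Σ b n xⁿ.
  g : ℕ → ℤ
  g zero    = 1ℤ
  g (suc n) = + b (suc n) - + 4 * + b n

  -- The coefficients of x^m f. Recursion in both arguments lets a common shift of row and exponent
  -- hold by computation.
  shifted : ℕ → ℕ → ℤ
  shifted zero    k       = + b k
  shifted (suc m) zero    = 0ℤ
  shifted (suc m) (suc k) = shifted m k

  -- The sum over k ≤ s of g (s - k) times the coefficient of x^(i+k) in x^m f. The recursion
  -- advances i while s decreases, which is the form of induction needed for the closed formula.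
  W : ℕ → Array
  W m i zero    = shifted m i
  W m i (suc s) = g (suc s) * shifted m i + W m (suc i) s

  -- The term k = s, with coefficient g 0 = 1, is set apart as the diagonal of the unitriangular
  -- matrix expected by `Δ-triangular`.
  W-sum : ∀ m i s → W m i s ≡ 1ℤ * shifted m (i ℕ.+ s) + sum {s} (λ k → g (s ∸ toℕ k) * shifted m (i ℕ.+ toℕ k))
  W-sum m i zero    rewrite ℕ.+-identityʳ i = solve-1 (shifted m i)
    where
    solve-1 : ∀ a → a ≡ 1ℤ * a + 0ℤ
    solve-1 = solve-∀
  W-sum m i (suc s) = begin
    g (suc s) * shifted m i + W m (suc i) s
      ≡⟨ cong (λ z → g (suc s) * shifted m i + z) (W-sum m (suc i) s) ⟩
    g (suc s) * shifted m i + (1ℤ * shifted m (suc i ℕ.+ s) + sum {s} (λ k → g (s ∸ toℕ k) * shifted m (suc i ℕ.+ toℕ k)))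
      ≡⟨ cong₂ (λ y z → g (suc s) * shifted m y + (1ℤ * shifted m (suc i ℕ.+ s) + z))
           (sym (ℕ.+-identityʳ i)) (sum-cong-≗ {s} λ k → cong (λ z → g (s ∸ toℕ k) * shifted m z) (sym (ℕ.+-suc i (toℕ k)))) ⟩
    g (suc s) * shifted m (i ℕ.+ 0) + (1ℤ * shifted m (suc i ℕ.+ s) + rest)
      ≡⟨ swap (g (suc s) * shifted m (i ℕ.+ 0)) (1ℤ * shifted m (suc i ℕ.+ s)) rest ⟩
    1ℤ * shifted m (suc i ℕ.+ s) + (g (suc s) * shifted m (i ℕ.+ 0) + rest)
      ≡⟨ cong (λ z → 1ℤ * shifted m z + (g (suc s) * shifted m (i ℕ.+ 0) + rest)) (ℕ.+-suc i s) ⟨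
    1ℤ * shifted m (i ℕ.+ suc s) + (g (suc s) * shifted m (i ℕ.+ 0) + rest) ∎
    where
    rest = sum {s} λ k → g (s ∸ toℕ k) * shifted m (i ℕ.+ suc (toℕ k))
    swap : ∀ a b c → a + (b + c) ≡ b + (a + c)
    swap = solve-∀

  W-shift : ∀ m i s → W (suc m) (suc i) s ≡ W m i s
  W-shift m i zero    = refl
  W-shift m i (suc s) = cong (λ z → g (suc s) * shifted m i + z) (W-shift m (suc i) s)

  W-shift-+ : ∀ m i s → W m (m ℕ.+ i) s ≡ W 0 i s
  W-shift-+ zero    i s = refl
  W-shift-+ (suc m) i s = trans (W-shift m (m ℕ.+ i) s) (W-shift-+ m i s)

  b-suc-ℤ : ∀ n → (1ℤ + + n) * + b (suc n) ≡ + 2 * (1ℤ + + 2 * + n) * + b n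
  b-suc-ℤ n = begin
    + suc n * + b (suc n)                 ≡⟨ pos-* (suc n) (b (suc n)) ⟨
    + (suc n ℕ.* b (suc n))               ≡⟨ cong +_ (b-suc n) ⟩
    + (2 ℕ.* suc (2 ℕ.* n) ℕ.* b n)       ≡⟨ pos-* (2 ℕ.* suc (2 ℕ.* n)) (b n) ⟩
    + (2 ℕ.* suc (2 ℕ.* n)) * + b n       ≡⟨ cong (_* + b n) (trans (pos-* 2 (suc (2 ℕ.* n)))
                                                (cong (λ z → + 2 * (1ℤ + z)) (pos-* 2 n))) ⟩
    + 2 * (1ℤ + + 2 * + n) * + b n        ∎

  -- Induction on s for all i at once. The recursive term has indices i + 1 and s, so the induction
  -- hypothesis carries the same factor i + s + 1; the recurrence of `b` at i then makes `b i` a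
  -- common factor.
  W-product : ∀ i s → + (i ℕ.+ s) * W 0 i s ≡ + (i ℕ.* b i ℕ.* b s)
  W-product i zero    = begin
    + (i ℕ.+ 0) * + b i          ≡⟨ cong (λ z → + z * + b i) (ℕ.+-identityʳ i) ⟩
    + i * + b i                  ≡⟨ pos-* i (b i) ⟨
    + (i ℕ.* b i)                ≡⟨ cong +_ (ℕ.*-identityʳ (i ℕ.* b i)) ⟨
    + (i ℕ.* b i ℕ.* 1)          ∎
  W-product i (suc s) = begin
    + (i ℕ.+ suc s) * (G * Bi + W 0 (suc i) s)
      ≡⟨ *-distribˡ-+ (+ (i ℕ.+ suc s)) (G * Bi) (W 0 (suc i) s) ⟩
    (I + (1ℤ + S)) * (G * Bi) + + (i ℕ.+ suc s) * W 0 (suc i) s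
      ≡⟨ cong (λ z → (I + (1ℤ + S)) * (G * Bi) + z) (trans (cong (λ z → + z * W 0 (suc i) s) (ℕ.+-suc i s)) (W-product (suc i) s)) ⟩
    (I + (1ℤ + S)) * (G * Bi) + + (suc i ℕ.* b (suc i) ℕ.* b s)
      ≡⟨ cong (λ z → (I + (1ℤ + S)) * (G * Bi) + z) (trans (pos-* (suc i ℕ.* b (suc i)) (b s))
           (cong (_* Bs) (trans (pos-* (suc i) (b (suc i))) (b-suc-ℤ i)))) ⟩
    (I + (1ℤ + S)) * ((Bs′ - + 4 * Bs) * Bi) + + 2 * (1ℤ + + 2 * I) * Bi * Bs
      ≡⟨ expand I S Bs Bs′ Bi ⟩
    I * Bi * Bs′ + Bi * ((1ℤ + S) * Bs′ - + 2 * (1ℤ + + 2 * S) * Bs)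
      -- The surplus over the desired product is `b i` times the recurrence at s, written as a
      -- difference.
      ≡⟨ cong (λ z → I * Bi * Bs′ + Bi * z) (i≡j⇒i-j≡0 (b-suc-ℤ s)) ⟩
    I * Bi * Bs′ + Bi * 0ℤ
      ≡⟨ trans (cong (λ z → I * Bi * Bs′ + z) (*-zeroʳ Bi)) (+-identityʳ (I * Bi * Bs′)) ⟩
    I * Bi * Bs′
      ≡⟨ trans (pos-* (i ℕ.* b i) (b (suc s))) (cong (_* Bs′) (pos-* i (b i))) ⟨
    + (i ℕ.* b i ℕ.* b (suc s)) ∎
    where
    I = + i
    S = + s
    G = g (suc s)
    Bi = + b i
    Bs = + b s
    Bs′ = + b (suc s)
    expand : ∀ I S Bs Bs′ Bi →
      (I + (1ℤ + S)) * ((Bs′ - + 4 * Bs) * Bi) + + 2 * (1ℤ + + 2 * I) * Bi * Bs ≡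
      I * Bi * Bs′ + Bi * ((1ℤ + S) * Bs′ - + 2 * (1ℤ + + 2 * S) * Bs)
    expand = solve-∀

  -- For m = 0 this says f g = 1, and it follows from `W-product` at i = 0, whose right-hand side
  -- vanishes. A larger m multiplies the series by a power of x.
  W-row-0 : ∀ m s → W m 0 s ≡ δ s m
  W-row-0 zero    zero    = refl
  W-row-0 zero    (suc s) = *-cancelˡ-≡ (+ suc s) (W 0 0 (suc s)) 0ℤ
    (trans (W-product 0 (suc s)) (sym (*-zeroʳ (+ suc s))))
  W-row-0 (suc m) zero    = refl
  W-row-0 (suc m) (suc s) = begin
    g (suc s) * 0ℤ + W (suc m) 1 s  ≡⟨ cong₂ _+_ (*-zeroʳ (g (suc s))) (W-shift m 0 s) ⟩
    0ℤ + W m 0 s                    ≡⟨ +-identityˡ (W m 0 s) ⟩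
    W m 0 s                         ≡⟨ W-row-0 m s ⟩
    δ s m                           ∎

  -- Starting at coefficient r of x^m f amounts to starting at coefficient 0 of x^(m-r) f.
  W-top : ∀ m r s → r ℕ.≤ m → W m r s ≡ δ (r ℕ.+ s) m
  W-top m       zero    s _         = W-row-0 m s
  W-top (suc m) (suc r) s (s≤s r≤m) = trans (W-shift m r s) (W-top m r s r≤m)

  -- From row m on the shift is used up, so row m + 1 + r is row r + 1 for f itself. Adding the
  -- column index m + 1 + s gives the Cauchy parameter m + 2.
  W-bottom : ∀ m r s → + (suc (suc m) ℕ.+ (r ℕ.+ s)) * W m (suc m ℕ.+ r) (suc m ℕ.+ s) ≡
    + (suc r ℕ.* b (suc r) ℕ.* b (suc m ℕ.+ s))
  W-bottom m r s = begin
    + (suc (suc m) ℕ.+ (r ℕ.+ s)) * W m (suc m ℕ.+ r) (suc m ℕ.+ s)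
      ≡⟨ cong₂ (λ x y → + x * W m y (suc m ℕ.+ s)) (commute m r s) (sym (ℕ.+-suc m r)) ⟩
    + (suc r ℕ.+ (suc m ℕ.+ s)) * W m (m ℕ.+ suc r) (suc m ℕ.+ s)
      ≡⟨ cong (+ (suc r ℕ.+ (suc m ℕ.+ s)) *_) (W-shift-+ m (suc r) (suc m ℕ.+ s)) ⟩
    + (suc r ℕ.+ (suc m ℕ.+ s)) * W 0 (suc r) (suc m ℕ.+ s)
      ≡⟨ W-product (suc r) (suc m ℕ.+ s) ⟩
    + (suc r ℕ.* b (suc r) ℕ.* b (suc m ℕ.+ s)) ∎
    where
    commute : ∀ m r s → suc (suc m) ℕ.+ (r ℕ.+ s) ≡ suc r ℕ.+ (suc m ℕ.+ s)
    commute = ℕ.solve-∀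

-- Matching the Cauchy evaluation with the product p.

module ProductIdentity where
  open import Data.Nat.Base
  open import Data.Nat.Properties
  open import Data.Nat.Tactic.RingSolver using (solve-∀)
  open import Relation.Binary.PropositionalEquality
  open ≡-Reasoning
  open Products
  open CentralBinomials
  open Cauchy using (cauchyProduct; factorialSquares)

  rising : ℕ → ℕ → ℕ
  rising a k = ∏< k λ i → a + i

  rising-! : ∀ a k → a ! * rising (suc a) k ≡ (a + k) !
  rising-! a zero    = trans (*-identityʳ (a !)) (cong _! (sym (+-identityʳ a)))
  rising-! a (suc k) = begin
    a ! * rising (suc a) (suc k)              ≡⟨ cong (a ! *_) (∏<-suc k (λ i → suc a + i)) ⟩
    a ! * (rising (suc a) k * (suc a + k))    ≡⟨ *-assoc (a !) (rising (suc a) k) (suc a + k) ⟨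
    a ! * rising (suc a) k * (suc a + k)      ≡⟨ cong (_* (suc a + k)) (rising-! a k) ⟩
    (a + k) ! * suc (a + k)                   ≡⟨ *-comm ((a + k) !) (suc (a + k)) ⟩
    suc (a + k) !                             ≡⟨ cong _! (+-suc a k) ⟨
    (a + suc k) !                             ∎

  -- The numerator of p_(m+1)(n), with i = u + 1 and j = i + v. Its value at n = 0 is the product of
  -- the denominators i + j.
  triangularProduct : ℕ → ℕ → ℕ
  triangularProduct m n = ∏< m λ u → ∏< (m ∸ u) λ v → 2 * n + suc u + (suc u + v)

  -- Without the row i = 1, both i and j start one higher; this adds 2 to every factor, as does
  -- raising n by one.
  triangularProduct-row : ∀ m n → triangularProduct (suc m) n ≡
    rising (2 * n + 2) (suc m) * triangularProduct m (suc n)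
  triangularProduct-row m n = cong₂ _*_
    (∏<-cong (suc m) λ v → first n v)
    (∏<-cong m λ u → ∏<-cong (m ∸ u) λ v → shift n u v)
    where
    first : ∀ n v → 2 * n + 1 + (1 + v) ≡ 2 * n + 2 + v
    first = solve-∀
    shift : ∀ n u v → 2 * n + suc (suc u) + (suc (suc u) + v) ≡ 2 * suc n + suc u + (suc u + v)
    shift = solve-∀

  -- Here the last entry of every row, j = m + 1, is split off, which leaves n unchanged. Together
  -- with `triangularProduct-row` it relates the triangles of size m at n and at n + 1.
  triangularProduct-column : ∀ m n → triangularProduct (suc m) n ≡
    triangularProduct m n * rising (2 * n + (2 + m)) (suc m)
  triangularProduct-column m n = begin
    ∏< (suc m) (λ u → ∏< (suc m ∸ u) (f u))                       ≡⟨ ∏<-cong-< (suc m) last-factor ⟩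
    ∏< (suc m) (λ u → ∏< (m ∸ u) (f u) * (2 * n + (2 + m) + u))   ≡⟨ ∏<-distrib-* (suc m) (λ u → ∏< (m ∸ u) (f u)) (λ u → 2 * n + (2 + m) + u) ⟩
    ∏< (suc m) (λ u → ∏< (m ∸ u) (f u)) * R                       ≡⟨ cong (_* R) (∏<-suc m (λ u → ∏< (m ∸ u) (f u))) ⟩
    triangularProduct m n * ∏< (m ∸ m) (f m) * R                  ≡⟨ cong (λ z → triangularProduct m n * ∏< z (f m) * R) (n∸n≡0 m) ⟩
    triangularProduct m n * 1 * R                                 ≡⟨ cong (_* R) (*-identityʳ (triangularProduct m n)) ⟩
    triangularProduct m n * R                                     ∎
    where
    R = rising (2 * n + (2 + m)) (suc m)
    f : ℕ → ℕ → ℕ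
    f u v = 2 * n + suc u + (suc u + v)
    arrange : ∀ n u k → 2 * n + suc u + (suc u + k) ≡ 2 * n + (2 + (u + k)) + u
    arrange = solve-∀
    last-factor : ∀ u → u < suc m → ∏< (suc m ∸ u) (f u) ≡ ∏< (m ∸ u) (f u) * (2 * n + (2 + m) + u)
    last-factor u (s≤s u≤m) = begin
      ∏< (suc m ∸ u) (f u)                      ≡⟨ cong (λ z → ∏< z (f u)) (+-∸-assoc 1 u≤m) ⟩
      ∏< (suc (m ∸ u)) (f u)                    ≡⟨ ∏<-suc (m ∸ u) (f u) ⟩
      ∏< (m ∸ u) (f u) * f u (m ∸ u)            ≡⟨ cong (∏< (m ∸ u) (f u) *_)
        (trans (arrange n u (m ∸ u)) (cong (λ z → 2 * n + (2 + z) + u) (m+[n∸m]≡n u≤m))) ⟩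
      ∏< (m ∸ u) (f u) * (2 * n + (2 + m) + u)  ∎

  cauchyProduct-last : ∀ x n → cauchyProduct x (suc n) ≡
    cauchyProduct x n * (rising (x + n) n * (rising (x + n) n * (x + (n + n))))
  cauchyProduct-last x n = begin
    ∏< (suc n) (λ r → ∏< (suc n) (h r))                      ≡⟨ ∏<-suc n (λ r → ∏< (suc n) (h r)) ⟩
    ∏< n (λ r → ∏< (suc n) (h r)) * ∏< (suc n) (h n)
      ≡⟨ cong₂ _*_ (trans (∏<-cong n λ r → ∏<-suc n (h r)) (∏<-distrib-* n (λ r → ∏< n (h r)) (λ r → h r n))) (∏<-suc n (h n)) ⟩
    cauchyProduct x n * ∏< n (λ r → h r n) * (∏< n (h n) * h n n)
      ≡⟨ cong₂ (λ a b → cauchyProduct x n * a * (b * h n n)) (∏<-cong n λ r → column x r n) (∏<-cong n λ s → row x n s) ⟩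
    cauchyProduct x n * rising (x + n) n * (rising (x + n) n * (x + (n + n)))
      ≡⟨ *-assoc (cauchyProduct x n) _ _ ⟩
    cauchyProduct x n * (rising (x + n) n * (rising (x + n) n * (x + (n + n)))) ∎
    where
    h : ℕ → ℕ → ℕ
    h r s = x + (r + s)
    column : ∀ x r n → x + (r + n) ≡ x + n + r
    column = solve-∀
    row : ∀ x n s → x + (n + s) ≡ x + n + s
    row = solve-∀

  ρ : ℕ → ℕ
  ρ r = suc r * b (suc r)

  σ : ℕ → ℕ → ℕ
  σ m s = b (suc m + s)

  ρ-factorial : ∀ n → ρ n * (n ! * n !) ≡ 2 * suc (2 * n) !
  ρ-factorial n = begin
    suc n * b (suc n) * (n ! * n !)        ≡⟨ cong (_* (n ! * n !)) (b-suc n) ⟩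
    2 * suc (2 * n) * b n * (n ! * n !)    ≡⟨ *-assoc (2 * suc (2 * n)) (b n) (n ! * n !) ⟩
    2 * suc (2 * n) * (b n * (n ! * n !))  ≡⟨ cong (2 * suc (2 * n) *_) (b-factorial n) ⟩
    2 * suc (2 * n) * (2 * n) !            ≡⟨ *-assoc 2 (suc (2 * n)) ((2 * n) !) ⟩
    2 * suc (2 * n) !                      ∎

  -- The quotient of two consecutive instances of `product-identity`, with denominators cleared.
  -- With F = m + 1 + 2n, both sides equal 2 (F + 1)! (2 (m + 1 + n))!; the factor f * f clears the
  -- denominator of the central binomial in `σ m n`.
  factor-identity : ∀ m n → let f = (suc m + n) ! ; q = rising (2 + m + n) n in
    ρ n * σ m n * (n ! * n !) * (rising (2 * n + 2) (suc m) * (f * f)) ≡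
    2 * (rising (2 * n + (2 + m)) (suc m) * (q * (q * (2 + m + (n + n)))) * (f * f))
  factor-identity m n = begin
    ρ n * σ m n * (n ! * n !) * (R₁ * (f * f))     ≡⟨ regroup₁ (ρ n) (σ m n) (n ! * n !) R₁ (f * f) ⟩
    ρ n * (n ! * n !) * R₁ * (σ m n * (f * f))     ≡⟨ cong₂ (λ y z → y * R₁ * z) (ρ-factorial n) (b-factorial (suc m + n)) ⟩
    2 * suc (2 * n) ! * R₁ * (2 * (suc m + n)) !   ≡⟨ cong (_* (2 * (suc m + n)) !) (*-assoc 2 (suc (2 * n) !) R₁) ⟩
    2 * (suc (2 * n) ! * R₁) * (2 * (suc m + n)) !
      ≡⟨ cong (λ z → 2 * z * (2 * (suc m + n)) !) R₁-factorial ⟩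
    2 * (suc F * F !) * (2 * (suc m + n)) !
      ≡⟨ cong₂ (λ y z → 2 * (y * F !) * z) (arrange₁ m n) (sym R₂-factorial) ⟩
    2 * ((2 + m + (n + n)) * F !) * (F ! * R₂)
      ≡⟨ cong₂ (λ y z → 2 * ((2 + m + (n + n)) * y) * (z * R₂)) q-factorial q-factorial ⟨
    2 * ((2 + m + (n + n)) * (f * q)) * (f * q * R₂) ≡⟨ regroup₂ (2 + m + (n + n)) f q R₂ ⟩
    2 * (R₂ * (q * (q * (2 + m + (n + n)))) * (f * f)) ∎
    where
    f = (suc m + n) !
    q = rising (2 + m + n) n
    F = suc m + n + n
    R₁ = rising (2 * n + 2) (suc m)
    R₂ = rising (2 * n + (2 + m)) (suc m)
    regroup₁ : ∀ r s n R f → r * s * n * (R * f) ≡ r * n * R * (s * f)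
    regroup₁ = solve-∀
    regroup₂ : ∀ x f q R → 2 * (x * (f * q)) * (f * q * R) ≡ 2 * (R * (q * (q * x)) * (f * f))
    regroup₂ = solve-∀
    arrange₁ : ∀ m n → suc (suc m + n + n) ≡ 2 + m + (n + n)
    arrange₁ = solve-∀
    arrange₂ : ∀ m n → suc (2 * n) + suc m ≡ suc (suc m + n + n)
    arrange₂ = solve-∀
    arrange₃ : ∀ m n → 2 * n + (2 + m) ≡ suc (suc m + n + n)
    arrange₃ = solve-∀
    arrange₄ : ∀ m n → suc m + n + n + suc m ≡ 2 * (suc m + n)
    arrange₄ = solve-∀
    q-factorial : f * q ≡ F !
    q-factorial = rising-! (suc m + n) n
    R₁-factorial : suc (2 * n) ! * R₁ ≡ suc F !
    R₁-factorial = trans (cong (λ z → suc (2 * n) ! * rising z (suc m)) (+-comm (2 * n) 2))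
      (trans (rising-! (suc (2 * n)) (suc m)) (cong _! (arrange₂ m n)))
    R₂-factorial : F ! * R₂ ≡ (2 * (suc m + n)) !
    R₂-factorial = trans (cong (λ z → F ! * rising z (suc m)) (arrange₃ m n))
      (trans (rising-! F (suc m)) (cong _! (arrange₄ m n)))

  -- Induction on n, comparing the factors gained by the two sides. The triangle gains R₂ / R₁, so
  -- the step is multiplied by R₁ (and by f * f for `factor-identity`) and the multiplier is
  -- cancelled at the end.
  product-identity : ∀ m n →
    ∏< n ρ * ∏< n (σ m) * factorialSquares n * triangularProduct m 0 ≡
    2 ^ n * triangularProduct m n * cauchyProduct (2 + m) n
  product-identity m zero    = initial (triangularProduct m 0)
    where
    initial : ∀ a → 1 * 1 * 1 * a ≡ 1 * a * 1
    initial = solve-∀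
  product-identity m (suc n) = *-cancelʳ-≡ _ _ (R₁ * (f * f)) (begin
    ∏< (suc n) ρ * ∏< (suc n) (σ m) * factorialSquares (suc n) * T₀ * (R₁ * (f * f))
      ≡⟨ cong (λ z → z * T₀ * (R₁ * (f * f)))
           (cong₂ _*_ (cong₂ _*_ (∏<-suc n ρ) (∏<-suc n (σ m))) (∏<-suc n (λ k → k ! * k !))) ⟩
    ∏< n ρ * ρ n * (∏< n (σ m) * σ m n) * (factorialSquares n * (n ! * n !)) * T₀ * (R₁ * (f * f))
      ≡⟨ regroup₁ (∏< n ρ) (ρ n) (∏< n (σ m)) (σ m n) (factorialSquares n) (n ! * n !) T₀ (R₁ * (f * f)) ⟩
    ∏< n ρ * ∏< n (σ m) * factorialSquares n * T₀ * (ρ n * σ m n * (n ! * n !) * (R₁ * (f * f)))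
      ≡⟨ cong₂ _*_ (product-identity m n) (factor-identity m n) ⟩
    2 ^ n * triangularProduct m n * V * (2 * (R₂ * Q * (f * f)))
      ≡⟨ regroup₂ (2 ^ n) (triangularProduct m n) V R₂ Q (f * f) ⟩
    2 * 2 ^ n * (triangularProduct m n * R₂) * (V * Q) * (f * f)
      -- Attaching the column j = m + 1 and then detaching the row i = 1 carries the triangle from n
      -- to n + 1.
      ≡⟨ cong₂ (λ y z → 2 * 2 ^ n * y * z * (f * f))
           (trans (sym (triangularProduct-column m n)) (triangularProduct-row m n))
           (sym (cauchyProduct-last (2 + m) n)) ⟩
    2 * 2 ^ n * (R₁ * triangularProduct m (suc n)) * cauchyProduct (2 + m) (suc n) * (f * f)
      ≡⟨ regroup₃ (2 ^ n) R₁ (triangularProduct m (suc n)) (cauchyProduct (2 + m) (suc n)) (f * f) ⟩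
    2 ^ suc n * triangularProduct m (suc n) * cauchyProduct (2 + m) (suc n) * (R₁ * (f * f)) ∎)
    where
    f = (suc m + n) !
    q = rising (2 + m + n) n
    Q = q * (q * (2 + m + (n + n)))
    R₁ = rising (2 * n + 2) (suc m)
    R₂ = rising (2 * n + (2 + m)) (suc m)
    T₀ = triangularProduct m 0
    V = cauchyProduct (2 + m) n
    instance
      _ : NonZero (R₁ * (f * f))
      _ = m*n≢0 R₁ (f * f)
            {{∏<-nonZero (suc m) λ i → subst (λ z → NonZero (z + i)) (+-comm 2 (2 * n)) _}}
            {{(suc m + n) !* (suc m + n) !≢0}}
    regroup₁ : ∀ a r b s u k t c → a * r * (b * s) * (u * k) * t * c ≡ a * b * u * t * (r * s * k * c)
    regroup₁ = solve-∀
    regroup₂ : ∀ p t v r q f → p * t * v * (2 * (r * q * f)) ≡ 2 * p * (t * r) * (v * q) * f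
    regroup₂ = solve-∀
    regroup₃ : ∀ p r t v f → 2 * p * (r * t) * v * f ≡ 2 * p * t * v * (r * f)
    regroup₃ = solve-∀

-- Clearing the denominators of p.

module RationalProducts where
  open import Data.Fin.Base using (toℕ)
  open import Data.Integer.Base as ℤ using (ℤ; +_)
  import Data.Integer.Properties as ℤ
  open import Data.Nat.Base as ℕ using (ℕ; zero; suc; _∸_)
  import Data.Nat.Properties as ℕ
  open import Data.Rational.Base
  open import Data.Rational.Properties
  open import Data.Rational.Unnormalised.Base as ℚᵘ using (mkℚᵘ; *≡*)
  import Data.Rational.Unnormalised.Properties as ℚᵘ
  open import Function.Base using (_∘_)
  open import Relation.Binary.PropositionalEquality
  open import Algebra.Properties.CommutativeMonoid.Sum *-1-commutativeMonoid using () renaming (sum to ∏)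
  open import Algebra.Bundles using (CommutativeMonoid)
  import Algebra.Properties.CommutativeSemigroup (CommutativeMonoid.commutativeSemigroup *-1-commutativeMonoid) as *
  open ≡-Reasoning
  open import Defs using (p)
  open Products
  open ProductIdentity using (triangularProduct)

  *-cancelʳ-≡-pos : ∀ {p q} r .{{_ : Positive r}} → p * r ≡ q * r → p ≡ q
  *-cancelʳ-≡-pos r pr≡qr = ≤-antisym (*-cancelʳ-≤-pos r (≤-reflexive pr≡qr))
                                      (*-cancelʳ-≤-pos r (≤-reflexive (sym pr≡qr)))

  -- `_/_` reduces to lowest terms, so the comparison is made among unnormalised fractions, whose
  -- product is computed without reduction.
  /-*-/ : ∀ i m j n .{{_ : ℕ.NonZero m}} .{{_ : ℕ.NonZero n}} →
    (i / m) * (j / n) ≡ ((i ℤ.* j) / (m ℕ.* n)) {{ℕ.m*n≢0 m n}}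
  /-*-/ i (suc m) j (suc n) = toℚᵘ-injective
    (ℚᵘ.≃-trans (toℚᵘ-homo-* (i / suc m) (j / suc n))
    (ℚᵘ.≃-trans (ℚᵘ.*-cong (toℚᵘ-fromℚᵘ (mkℚᵘ i m)) (toℚᵘ-fromℚᵘ (mkℚᵘ j n)))
                (ℚᵘ.≃-sym (toℚᵘ-fromℚᵘ (mkℚᵘ i m ℚᵘ.* mkℚᵘ j n)))))

  /1-* : ∀ i j → (i ℤ.* j) / 1 ≡ (i / 1) * (j / 1)
  /1-* i j = sym (/-*-/ i 1 j 1)

  /-*-denominator : ∀ i d .{{_ : ℕ.NonZero d}} → (i / d) * (+ d / 1) ≡ i / 1
  /-*-denominator i d@(suc d-1) = trans (/-*-/ i d (+ d) 1)
    (fromℚᵘ-cong (*≡* {mkℚᵘ (i ℤ.* + d) (d-1 ℕ.* 1)} {mkℚᵘ i 0}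
      (trans (ℤ.*-identityʳ (i ℤ.* + d)) (cong (λ z → i ℤ.* + z) (sym (ℕ.*-identityʳ d))))))

  ∏-clear-denominators : ∀ k (f : ℕ → ℚ) (d e : ℕ → ℕ) → (∀ i → f i * (+ d i / 1) ≡ + e i / 1) →
    ∏ {k} (f ∘ toℕ) * (+ ∏< k d / 1) ≡ + ∏< k e / 1
  ∏-clear-denominators zero    f d e fd≗e = refl
  ∏-clear-denominators (suc k) f d e fd≗e = begin
    f 0 * F * (+ (d 0 ℕ.* ∏< k (d ∘ suc)) / 1)
      ≡⟨ cong (f 0 * F *_) (pos-*-/1 (d 0) (∏< k (d ∘ suc))) ⟩
    f 0 * F * ((+ d 0 / 1) * (+ ∏< k (d ∘ suc) / 1))
      ≡⟨ *.interchange (f 0) F (+ d 0 / 1) (+ ∏< k (d ∘ suc) / 1) ⟩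
    f 0 * (+ d 0 / 1) * (F * (+ ∏< k (d ∘ suc) / 1))
      ≡⟨ cong₂ _*_ (fd≗e 0) (∏-clear-denominators k (f ∘ suc) (d ∘ suc) (e ∘ suc) (fd≗e ∘ suc)) ⟩
    (+ e 0 / 1) * (+ ∏< k (e ∘ suc) / 1)
      ≡⟨ pos-*-/1 (e 0) (∏< k (e ∘ suc)) ⟨
    + ∏< (suc k) e / 1 ∎
    where
    F = ∏ {k} (f ∘ suc ∘ toℕ)
    pos-*-/1 : ∀ m n → + (m ℕ.* n) / 1 ≡ (+ m / 1) * (+ n / 1)
    pos-*-/1 m n = trans (cong (_/ 1) (ℤ.pos-* m n)) (/1-* (+ m) (+ n))

  p-triangularProduct : ∀ m n → p (suc m) n * (+ triangularProduct m 0 / 1) ≡ + triangularProduct m n / 1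
  p-triangularProduct m n = ∏-clear-denominators m
    (λ u → ∏ {m ∸ u} λ v → quotient u (toℕ v))
    (λ u → ∏< (m ∸ u) (den u)) (λ u → ∏< (m ∸ u) (num u)) λ u →
    ∏-clear-denominators (m ∸ u) (quotient u) (den u) (num u) λ v →
    /-*-denominator (+ num u v) (den u v)
    where
    num den : ℕ → ℕ → ℕ
    num u v = 2 ℕ.* n ℕ.+ suc u ℕ.+ (suc u ℕ.+ v)
    den u v = suc u ℕ.+ (suc u ℕ.+ v)
    quotient : ℕ → ℕ → ℚ
    quotient u v = + num u v / den u v

-- Vanishing and cross-multiplied closed form of the Hankel determinants.

module HankelDeterminants where
  open import Data.Fin.Base using (toℕ)
  open import Data.Fin.Properties using (toℕ<n)
  open import Data.Integer.Base using (+_; -_; 0ℤ; 1ℤ; -1ℤ; _+_; _*_; _^_; _⊖_)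
  open import Data.Integer.Properties
  open import Data.Nat.Base as ℕ using (ℕ; zero; suc; _<_; _≤_; s≤s; s<s)
  import Data.Nat.Properties as ℕ
  open import Data.Nat.Combinatorics using (_C_)
  open import Relation.Binary.PropositionalEquality
  open ≡-Reasoning
  open import Defs using (B; D)
  open Products
  open Determinants
  open Cauchy
  open CentralBinomials
  open Convolution
  open ProductIdentity

  B-shifted : ∀ m k → B (+ k + - + m) ≡ shifted m k
  B-shifted zero    k       = cong B (+-identityʳ (+ k))
  B-shifted (suc m) zero    = refl
  B-shifted (suc m) (suc k) = begin
    B (suc k ⊖ suc m)   ≡⟨ cong B ([1+m]⊖[1+n]≡m⊖n k m) ⟩
    B (k ⊖ m)           ≡⟨ cong B (m-n≡m⊖n k m) ⟨
    B (+ k + - + m)     ≡⟨ B-shifted m k ⟩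
    shifted m k         ∎

  shifted-< : ∀ {m k} → k < m → shifted m k ≡ 0ℤ
  shifted-< {suc m} {zero}  _         = refl
  shifted-< {suc m} {suc k} (s<s k<m) = shifted-< k<m

  -- The first row consists of the B_(j-m) with j < n ≤ m, all of negative index.
  D-vanishes : ∀ m n → 1 ≤ n → n ≤ m → D (- + m) B n ≡ 0ℤ
  D-vanishes m (suc n) _ n≤m = det-zero-row {n} (λ r s → B (+ toℕ r + + toℕ s + - + m)) λ j →
    trans (B-shifted m (toℕ j)) (shifted-< (ℕ.<-≤-trans (toℕ<n j) n≤m))

  D≡Δ-W : ∀ m n → D (- + m) B n ≡ Δ n (W m)
  D≡Δ-W m n = begin
    D (- + m) B n                     ≡⟨ det-cong {n} {λ r s → B (+ toℕ r + + toℕ s + - + m)} (λ r s → B-shifted m (toℕ r ℕ.+ toℕ s)) ⟩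
    Δ n A                             ≡⟨ *-identityˡ (Δ n A) ⟨
    1ℤ * Δ n A                        ≡⟨ cong (λ z → + z * Δ n A) (∏<-1 n) ⟨
    + ∏< n (λ _ → 1) * Δ n A          ≡⟨ Δ-triangular n {A} {W m} (λ _ → 1) (λ s k → g (s ℕ.∸ k)) (W-sum m) ⟨
    Δ n (W m)                         ∎
    where
    A : Array
    A r s = shifted m (r ℕ.+ s)
    ∏<-1 : ∀ n → ∏< n (λ _ → 1) ≡ 1
    ∏<-1 zero    = refl
    ∏<-1 (suc n) = trans (ℕ.*-identityˡ _) (∏<-1 n)

  block : ℕ → Array
  block m r s = W m (suc m ℕ.+ r) (suc m ℕ.+ s)

  D-block : ∀ m N → D (- + m) B (suc m ℕ.+ N) ≡ sgn (suc m C 2) * Δ N (block m)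
  D-block m N = trans (D≡Δ-W m (suc m ℕ.+ N))
    (Δ-antidiagonal (suc m) N (W m) λ { r s (s≤s r≤m) → W-top m r s r≤m })

  -- The product V of the Cauchy denominators is positive, so it suffices to prove the equation
  -- multiplied by V, where `Δ-cauchy` and `product-identity` apply.
  Δ-block : ∀ m N → Δ N (block m) * + triangularProduct m 0 ≡ + (2 ℕ.^ N ℕ.* triangularProduct m N)
  Δ-block m N = *-cancelˡ-≡ (+ V) (Δ N (block m) * + T₀) (+ (2 ℕ.^ N ℕ.* triangularProduct m N)) {{V≢0}} (begin
    + V * (Δ N (block m) * + T₀)       ≡⟨ *-assoc (+ V) (Δ N (block m)) (+ T₀) ⟨
    + V * Δ N (block m) * + T₀
      ≡⟨ cong (_* + T₀) (Δ-cauchy N (suc m) (block m) ρ (σ m) (λ s → b≢0 (suc m ℕ.+ s)) (W-bottom m)) ⟩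
    + (∏< N ρ ℕ.* ∏< N (σ m) ℕ.* factorialSquares N) * + T₀
      ≡⟨ pos-* (∏< N ρ ℕ.* ∏< N (σ m) ℕ.* factorialSquares N) T₀ ⟨
    + (∏< N ρ ℕ.* ∏< N (σ m) ℕ.* factorialSquares N ℕ.* T₀)
      ≡⟨ cong +_ (trans (product-identity m N) (ℕ.*-comm (2 ℕ.^ N ℕ.* triangularProduct m N) V)) ⟩
    + (V ℕ.* (2 ℕ.^ N ℕ.* triangularProduct m N))
      ≡⟨ pos-* V (2 ℕ.^ N ℕ.* triangularProduct m N) ⟩
    + V * + (2 ℕ.^ N ℕ.* triangularProduct m N) ∎)
    where
    T₀ = triangularProduct m 0
    V = cauchyProduct (2 ℕ.+ m) N
    V≢0 : ℕ.NonZero V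
    V≢0 = ∏<-nonZero N λ r → ∏<-nonZero N λ s → _

  -- Two powers meet here: `sgn` uses the exponentiation of a general semiring, as `det` does, and
  -- the right-hand side uses the one built for ℤ.
  sgn≡-1^ : ∀ n → sgn n ≡ -1ℤ ^ n
  sgn≡-1^ zero    = refl
  sgn≡-1^ (suc n) = cong (-1ℤ *_) (sgn≡-1^ n)

  pos-2^ : ∀ n → + (2 ℕ.^ n) ≡ (+ 2) ^ n
  pos-2^ zero    = refl
  pos-2^ (suc n) = trans (pos-* 2 (2 ℕ.^ n)) (cong (+ 2 *_) (pos-2^ n))

  D-closed-form : ∀ m N → D (- + m) B (suc m ℕ.+ N) * + triangularProduct m 0 ≡
    -1ℤ ^ (suc m C 2) * (+ 2) ^ N * + triangularProduct m N
  D-closed-form m N = begin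
    D (- + m) B (suc m ℕ.+ N) * + triangularProduct m 0
      ≡⟨ cong (_* + triangularProduct m 0) (D-block m N) ⟩
    sgn (suc m C 2) * Δ N (block m) * + triangularProduct m 0
      ≡⟨ *-assoc (sgn (suc m C 2)) (Δ N (block m)) (+ triangularProduct m 0) ⟩
    sgn (suc m C 2) * (Δ N (block m) * + triangularProduct m 0)
      ≡⟨ cong₂ _*_ (sgn≡-1^ (suc m C 2)) (trans (Δ-block m N) (pos-* (2 ℕ.^ N) (triangularProduct m N))) ⟩
    -1ℤ ^ (suc m C 2) * (+ (2 ℕ.^ N) * + triangularProduct m N)
      ≡⟨ cong (λ z → -1ℤ ^ (suc m C 2) * (z * + triangularProduct m N)) (pos-2^ N) ⟩
    -1ℤ ^ (suc m C 2) * ((+ 2) ^ N * + triangularProduct m N)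
      ≡⟨ *-assoc (-1ℤ ^ (suc m C 2)) ((+ 2) ^ N) (+ triangularProduct m N) ⟨
    -1ℤ ^ (suc m C 2) * (+ 2) ^ N * + triangularProduct m N ∎

-- Passage to rational numbers and the theorem.

open import Defs
open import Data.Integer.Base using (ℤ; +_; -_; 0ℤ; -1ℤ; _*_; _^_)
open import Data.Nat.Base using (ℕ; suc; _+_; _∸_; _≤_; NonZero)
import Data.Nat.Properties as ℕ
open import Data.Nat.Combinatorics using (_C_)
open import Data.Product.Base using (_×_; _,_)
open import Data.Rational.Base as ℚ using (ℚ; _/_)
import Data.Rational.Properties as ℚ
open import Relation.Binary.PropositionalEquality using (_≡_; sym; trans; cong; module ≡-Reasoning)
open Products using (∏<-nonZero)
open ProductIdentity using (triangularProduct)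
open RationalProducts using (/1-*; p-triangularProduct; *-cancelʳ-≡-pos)
open HankelDeterminants using (D-vanishes; D-closed-form)

D-quotient : ∀ m N → D (- (+ m)) B (suc m + N) / 1 ≡
  (-1ℤ ^ (suc m C 2) * (+ 2) ^ N) / 1 ℚ.* p (suc m) N
D-quotient m N = *-cancelʳ-≡-pos (+ T 0 / 1) {{ℚ.normalize-pos (T 0) 1 {{_}} {{T₀≢0}}}} (begin
  d / 1 ℚ.* (+ T 0 / 1)                 ≡⟨ /1-* d (+ T 0) ⟨
  (d * + T 0) / 1                       ≡⟨ cong (_/ 1) (D-closed-form m N) ⟩
  (c * + T N) / 1                       ≡⟨ /1-* c (+ T N) ⟩
  c / 1 ℚ.* (+ T N / 1)                 ≡⟨ cong (c / 1 ℚ.*_) (p-triangularProduct m N) ⟨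
  c / 1 ℚ.* (p (suc m) N ℚ.* (+ T 0 / 1)) ≡⟨ ℚ.*-assoc (c / 1) (p (suc m) N) (+ T 0 / 1) ⟨
  c / 1 ℚ.* p (suc m) N ℚ.* (+ T 0 / 1) ∎)
  where
  open ≡-Reasoning
  d = D (- (+ m)) B (suc m + N)
  c = -1ℤ ^ (suc m C 2) * (+ 2) ^ N
  T = triangularProduct m
  T₀≢0 : NonZero (T 0)
  T₀≢0 = ∏<-nonZero m λ u → ∏<-nonZero (m ∸ u) λ v → _

theorem7 : ∀ (m : ℕ) → 1 ≤ m →
    (∀ (n : ℕ) → 1 ≤ n → n ≤ m → D (- (+ m)) B n ≡ 0ℤ) ×
    (∀ (n : ℕ) → m + 1 ≤ n →
    D (- (+ m)) B n / 1 ≡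
    (-1ℤ ^ ((m + 1) C 2) * (+ 2) ^ (n ∸ m ∸ 1)) / 1 ℚ.* p (m + 1) (n ∸ m ∸ 1))
theorem7 m _ = D-vanishes m , large
  where
  large : ∀ n → m + 1 ≤ n → D (- (+ m)) B n / 1 ≡
    (-1ℤ ^ ((m + 1) C 2) * (+ 2) ^ (n ∸ m ∸ 1)) / 1 ℚ.* p (m + 1) (n ∸ m ∸ 1)
  -- The block size is N = n - (m + 1); the bound on n ensures that (m + 1) + N gives back n under
  -- truncated subtraction.
  large n m+1≤n rewrite ℕ.∸-+-assoc n m 1 | ℕ.+-comm m 1 =
    trans (cong (λ k → D (- (+ m)) B k / 1) (sym (ℕ.m+[n∸m]≡n m+1≤n)))
          (D-quotient m (n ∸ suc m))
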